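{- Let $(h(n))_{n\ge1}$ be any sequence of positive real numbers with $h(1)=1$, and for $n\ge2$ let $\rho_n^h$ be the spectral radius of the matrix $M_n^h$. Then \[ 0<\rho_2^h<\rho_3^h<\rho_4^h<\cdots . \]
   Context: Let $\sigma(k)=\sum_{d\mid k}d$. The sequence $(c_n)_{n\ge0}$ is defined by $c_0:=1$ and $c_n:=\sum_{k=0}^{n-1}(-1)^{n-k+1}\sigma(n-k+1)\,c_k$ for $n\ge1$. For $n\ge2$, $M_n^h$ is the $(n-1)\times(n-1)$ matrix with entries, for $1\le i,j\le n-1$, \[ (M_n^h)_{ij}=\begin{cases} c_{i-j+1}\,h(j), & i\ge j-1,\\ 0, & j>i+1.\end{cases} \] -}

module Defs where

open import Algebra.Bundles using (CommutativeRing)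
open import Algebra.Bundles.Raw using (RawMonoid)
open import Algebra.Core using (Op₁; Op₂)
import Algebra.Definitions.RawMonoid as RawMonoidDefs
open import Algebra.Properties.Monoid.Sum using (sum-cong-≗)
open import Algebra.Structures using (IsCommutativeRing)
open import Data.Fin.Base using (Fin; toℕ)
open import Data.Fin.Properties using (toℕ<n)
open import Data.Integer.Base as ℤ using (ℤ; +_; -[1+_])
import Data.Integer.Properties as ℤ
open import Data.List.Base as List using (filter; upTo)
open import Data.Nat.ListAction using (sum)
open import Data.Nat.Base as ℕ using (ℕ; zero; suc; _∸_)
open import Data.Nat.Divisibility using (_∣?_)
open import Data.Nat.Induction using (<-rec; <-wellFounded)
import Data.Nat.Properties as ℕ
open import Data.Product.Base using (∃; ∃-syntax; _×_; _,_)
open import Data.Sum.Base using (_⊎_)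
open import Induction.WellFounded using (module FixPoint)
open import Level using (0ℓ)
open import Relation.Binary.Core using (Rel)
open import Relation.Binary.PropositionalEquality
  using (_≡_; refl; cong)
open import Relation.Binary.Structures using (IsStrictTotalOrder)
open import Relation.Nullary using (¬_; yes; no)

-- The real numbers, axiomatised (up to isomorphism) as a Dedekind-complete
-- ordered field.  The trichotomy in IsStrictTotalOrder and the existence of
-- suprema of arbitrary bounded inhabited predicates make these the classical
-- reals.
record CompleteOrderedField : Set₁ where
  infix  8 -_
  infixl 7 _*_
  infixl 6 _+_
  infix  4 _≈_ _<_ _≤_
  field
    Carrier            : Set
    _≈_                : Rel Carrier 0ℓ
    _<_                : Rel Carrier 0ℓ
    _+_ _*_            : Op₂ Carrier
    -_                 : Op₁ Carrier
    0# 1#              : Carrier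
    isCommutativeRing  : IsCommutativeRing _≈_ _+_ _*_ -_ 0# 1#
    isStrictTotalOrder : IsStrictTotalOrder _≈_ _<_
    1≉0                : ¬ (1# ≈ 0#)
    inverse            : ∀ x → ¬ (x ≈ 0#) → ∃[ y ] x * y ≈ 1#
    +-monoˡ-<          : ∀ z {x y} → x < y → x + z < y + z
    *-pos              : ∀ {x y} → 0# < x → 0# < y → 0# < x * y

  _≤_ : Rel Carrier 0ℓ
  x ≤ y = x < y ⊎ x ≈ y

  UpperBound : (Carrier → Set) → Carrier → Set
  UpperBound S b = ∀ x → S x → x ≤ b

  field
    supremum : (S : Carrier → Set) → ∃ S → ∃ (UpperBound S) →
               ∃[ s ] UpperBound S s × (∀ b → UpperBound S b → s ≤ b)

  commutativeRing : CommutativeRing 0ℓ 0ℓ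
  commutativeRing = record { isCommutativeRing = isCommutativeRing }

σ : ℕ → ℕ
σ k = sum (filter (_∣? k) (List.map suc (upTo k)))

sumℤ : ∀ {n} → (Fin n → ℤ) → ℤ
sumℤ = RawMonoidDefs.sum ℤ.+-0-rawMonoid

cStep : ∀ n → (∀ {k} → k ℕ.< n → ℤ) → ℤ
cStep zero      _    = + 1
cStep n@(suc _) prev = sumℤ λ (k : Fin n) →
  ℤ.-1ℤ ℤ.^ (n ∸ toℕ k ℕ.+ 1) ℤ.* + σ (n ∸ toℕ k ℕ.+ 1) ℤ.* prev (toℕ<n k)

c : ℕ → ℤ
c = <-rec (λ _ → ℤ) cStep

c-zero : c 0 ≡ + 1
c-zero = refl

c-rec : ∀ n → 1 ℕ.≤ n →
  c n ≡ sumℤ λ (k : Fin n) →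
          ℤ.-1ℤ ℤ.^ (n ∸ toℕ k ℕ.+ 1) ℤ.* + σ (n ∸ toℕ k ℕ.+ 1) ℤ.* c (toℕ k)
c-rec (suc n) _ = unfold-wfRec {suc n}
  where
  ext : ∀ n {f g : ∀ {k} → k ℕ.< n → ℤ} →
        (∀ {k} (k<n : k ℕ.< n) → f k<n ≡ g k<n) → cStep n f ≡ cStep n g
  ext zero    _   = refl
  ext (suc n) f≗g = sum-cong-≗ ℤ.+-0-monoid λ k →
    cong (ℤ.-1ℤ ℤ.^ (suc n ∸ toℕ k ℕ.+ 1) ℤ.* + σ (suc n ∸ toℕ k ℕ.+ 1) ℤ.*_)
         (f≗g (toℕ<n k))
  open FixPoint <-wellFounded (λ _ → ℤ) cStep ext using (unfold-wfRec)

module Spectral (R : CompleteOrderedField) where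
  open CompleteOrderedField R public renaming (Carrier to ℝ)
  open CommutativeRing commutativeRing using (+-rawMonoid; _-_)

  fromℤ : ℤ → ℝ
  fromℤ (+ n)    = RawMonoidDefs._×_ +-rawMonoid n 1#
  fromℤ -[1+ n ] = - RawMonoidDefs._×_ +-rawMonoid (suc n) 1#

  record ℂ : Set where
    constructor _+i_
    field
      re im : ℝ
  open ℂ public

  infix  4 _≈ᶜ_
  infixl 6 _+ᶜ_
  infixl 7 _*ᶜ_

  _≈ᶜ_ : Rel ℂ 0ℓ
  z ≈ᶜ w = re z ≈ re w × im z ≈ im w

  0ᶜ : ℂ
  0ᶜ = 0# +i 0#

  _+ᶜ_ : Op₂ ℂ
  z +ᶜ w = (re z + re w) +i (im z + im w)

  _*ᶜ_ : Op₂ ℂ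
  z *ᶜ w = (re z * re w - im z * im w) +i (re z * im w + im z * re w)

  ofReal : ℝ → ℂ
  ofReal x = x +i 0#

  sumᶜ : ∀ {n} → (Fin n → ℂ) → ℂ
  sumᶜ = RawMonoidDefs.sum +ᶜ-rawMonoid
    where
    +ᶜ-rawMonoid : RawMonoid 0ℓ 0ℓ
    +ᶜ-rawMonoid = record { Carrier = ℂ ; _≈_ = _≈ᶜ_ ; _∙_ = _+ᶜ_ ; ε = 0ᶜ }

  -- |z| = r, as a relation, since the field comes with no square root function.
  IsModulus : ℂ → ℝ → Set
  IsModulus z r = 0# ≤ r × r * r ≈ re z * re z + im z * im z

  Matrix : Set → ℕ → Set
  Matrix A m = Fin m → Fin m → A

  IsEigenvalue : ∀ {m} → Matrix ℂ m → ℂ → Set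
  IsEigenvalue {m} A μ = ∃ λ (v : Fin m → ℂ) → ¬ (∀ i → v i ≈ᶜ 0ᶜ) ×
    (∀ i → sumᶜ (λ j → A i j *ᶜ v j) ≈ᶜ μ *ᶜ v i)

  -- ρ is the largest modulus of a complex eigenvalue of the real matrix A.
  -- This determines ρ up to _≈_.
  IsSpectralRadius : ∀ {m} → Matrix ℝ m → ℝ → Set
  IsSpectralRadius {m} A ρ =
    (∃[ μ ] IsEigenvalue Aᶜ μ × IsModulus μ ρ) ×
    (∀ μ r → IsEigenvalue Aᶜ μ → IsModulus μ r → r ≤ ρ)
    where
    Aᶜ : Matrix ℂ m
    Aᶜ i j = ofReal (A i j)

  -- The entry in row i and column j, numbered from 1.
  entry : (ℕ → ℝ) → ℕ → ℕ → ℝ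
  entry h i j with j ℕ.≤? i ℕ.+ 1
  ... | yes _ = fromℤ (c (i ℕ.+ 1 ∸ j)) * h j
  ... | no  _ = 0#

  M : (ℕ → ℝ) → (n : ℕ) → Matrix ℝ (n ∸ 1)
  M h n i j = entry h (suc (toℕ i)) (suc (toℕ j))

module Submission where

-- Write p₀ = 1 and x pₖ / h(k+1) = c₀ pₖ₊₁ + c₁ pₖ + … + cₖ₊₁ p₀.  Since M_n^h is lower Hessenberg, x is an
-- eigenvalue iff pₙ₋₁(x) = 0, with eigenvector (pₖ(x) / h(k+1))ₖ.  If x ≥ 0 is such a root and p₀, …, pₙ₋₂ are
-- positive at x, this eigenvector is positive, hence x is the spectral radius (Collatz–Wielandt).  At the largest
-- root ρ of pₙ₋₁ the recursion gives pₙ(ρ) = − (c₂ pₙ₋₂(ρ) + … + cₙ p₀) < 0, so pₙ has a root beyond ρ, which by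
-- the same criterion is the next spectral radius.
--
-- All this needs c > 0.  The generating function of c is 1 / ∑ σ(m+1)(-x)ᵐ.  Multiplying the denominator by
-- 1 + x − x², the beginning of ∏ (1 − (−x)ⁿ), leaves 1 − 2x − 5x⁴ + …, and the recurrence c(n+3) = 2 c(n+2) + …
-- thus obtained implies 2 c(n+1) ≥ 3 c(n) inductively.

open import Defs
open import Algebra.Bundles using (CommutativeRing)
import Algebra.Properties.AbelianGroup as AbelianGroupProperties
import Algebra.Properties.Monoid.Sum as MonoidSum
import Algebra.Properties.Ring as RingProperties
import Algebra.Properties.Semiring.Mult.TCOptimised as Mult
import Algebra.Solver.Ring as RingSolver
open import Algebra.Solver.Ring.AlmostCommutativeRing using (fromCommutativeRing; _-Raw-AlmostCommutative⟶_)
open import Data.Fin.Base as Fin using (Fin; toℕ)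
import Data.Fin.Properties as Fin
open import Data.Integer.Base as ℤ using (ℤ; +_; -[1+_])
import Data.Integer.Properties as ℤ
open import Data.Integer.Tactic.RingSolver using (solve-∀)
open import Data.List.Base as List using (List; []; _∷_; filter; upTo; length)
import Data.List.Properties as List
open import Data.List.Relation.Unary.All as All using (All; []; _∷_)
import Data.List.Relation.Unary.All.Properties as All
open import Data.List.Relation.Unary.Linked using (Linked; [-]; _∷_)
open import Data.Maybe.Base as Maybe using ()
open import Data.Nat.Base as ℕ using (ℕ; zero; suc; _∸_; z≤n; s≤s)
open import Data.Nat.Divisibility using (_∣?_)
open import Data.Nat.ListAction using (sum)
import Data.Nat.Properties as ℕ
import Data.Nat.Tactic.RingSolver as ℕ-Solver
open import Data.Product.Base using (∃-syntax; _×_; _,_; proj₁; proj₂)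
open import Data.Sum.Base using (_⊎_; inj₁; inj₂)
open import Function.Base using (_∘_)
open import Relation.Binary.Bundles using (StrictPartialOrder)
import Relation.Binary.Construct.StrictToNonStrict as StrictToNonStrict
open import Relation.Binary.Definitions using (tri<; tri≈; tri>)
open import Relation.Binary.PropositionalEquality as ≡ using (_≡_; cong; cong₂; subst; subst₂)
import Relation.Binary.Reasoning.StrictPartialOrder as StrictPartialOrderReasoning
open import Relation.Binary.Structures using (IsStrictTotalOrder; IsTotalOrder)
open import Relation.Nullary using (¬_; Dec; yes; no; contradiction)
open import Relation.Nullary.Decidable using (dec⇒maybe; from-yes)

-- Convolutions as dot products with a reversed history.

history : ∀ {a} {A : Set a} → (ℕ → A) → ℕ → List A
history x zero    = []
history x (suc n) = x n ∷ history x n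

module Dot {a ℓ} (R : CommutativeRing a ℓ) where
  open CommutativeRing R
  open MonoidSum +-monoid using () renaming (sum to ∑; sum-init-last to ∑-init-last; sum-cong-≗ to ∑-cong-≗)
  open import Relation.Binary.Reasoning.Setoid setoid

  dot : (ℕ → Carrier) → List Carrier → Carrier
  dot a []       = 0#
  dot a (x ∷ xs) = a 0 * x + dot (a ∘ suc) xs

  -- The history lists the latest value first. Splitting off the last summand therefore pairs `a 0`
  -- with `x n`, and the rest is the same convolution for the shifted coefficients `a ∘ suc`. In
  -- this form a recurrence has coefficients that do not depend on `n`.
  convolution≈dot : ∀ (a x : ℕ → Carrier) n →
    ∑ {n} (λ j → a (n ∸ suc (toℕ j)) * x (toℕ j)) ≈ dot a (history x n)
  convolution≈dot a x zero    = refl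
  convolution≈dot a x (suc n) = begin
    ∑ {suc n} t
      ≈⟨ ∑-init-last t ⟩
    ∑ {n} (t ∘ Fin.inject₁) + t (Fin.fromℕ n)
      ≡⟨ cong₂ _+_ (∑-cong-≗ init≗) last≡ ⟩
    ∑ {n} (λ j → a (suc (n ∸ suc (toℕ j))) * x (toℕ j)) + a 0 * x n
      ≈⟨ +-comm _ _ ⟩
    a 0 * x n + ∑ {n} (λ j → a (suc (n ∸ suc (toℕ j))) * x (toℕ j))
      ≈⟨ +-congˡ (convolution≈dot (a ∘ suc) x n) ⟩
    a 0 * x n + dot (a ∘ suc) (history x n) ∎
    where
    t : Fin (suc n) → Carrier
    t j = a (n ∸ toℕ j) * x (toℕ j)
    init≗ : ∀ j → t (Fin.inject₁ j) ≡ a (suc (n ∸ suc (toℕ j))) * x (toℕ j)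
    init≗ j rewrite Fin.toℕ-inject₁ j | ≡.sym (ℕ.+-∸-assoc 1 (Fin.toℕ<n j)) = ≡.refl
    last≡ : t (Fin.fromℕ n) ≡ a 0 * x n
    last≡ rewrite Fin.toℕ-fromℕ n | ℕ.n∸n≡0 n = ≡.refl

-- Positivity of the sequence `c`.

module Positivity where
  open ≡ using (refl; sym; trans)
  open Dot ℤ.+-*-commutativeRing using () renaming (dot to dotℤ; convolution≈dot to convolution≡dotℤ)

  dotℤ-combine : ∀ f g h xs → dotℤ (λ j → f j ℤ.+ g j ℤ.- h j) xs ≡ dotℤ f xs ℤ.+ dotℤ g xs ℤ.- dotℤ h xs
  dotℤ-combine f g h []       = refl
  dotℤ-combine f g h (x ∷ xs) =
    trans (cong (λ u → (f 0 ℤ.+ g 0 ℤ.- h 0) ℤ.* x ℤ.+ u) (dotℤ-combine (f ∘ suc) (g ∘ suc) (h ∘ suc) xs))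
          (regroup (f 0) (g 0) (h 0) x _ _ _)
    where
    regroup : ∀ a b c x r s t → (a ℤ.+ b ℤ.- c) ℤ.* x ℤ.+ (r ℤ.+ s ℤ.- t) ≡
                                (a ℤ.* x ℤ.+ r) ℤ.+ (b ℤ.* x ℤ.+ s) ℤ.- (c ℤ.* x ℤ.+ t)
    regroup = solve-∀

  dotℤ-scale : ∀ k f xs → dotℤ (λ j → k ℤ.* f j) xs ≡ k ℤ.* dotℤ f xs
  dotℤ-scale k f []       = sym (ℤ.*-zeroʳ k)
  dotℤ-scale k f (x ∷ xs) = trans (cong₂ ℤ._+_ (ℤ.*-assoc k (f 0) x) (dotℤ-scale k (f ∘ suc) xs))
                                  (sym (ℤ.*-distribˡ-+ k _ _))

  -- At most `k` divisors, each at most `k`. A polynomial bound is enough, as it only has to compete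
  -- with the geometric factor 3/2.
  σ≤square : ∀ k → σ k ℕ.≤ k ℕ.* k
  σ≤square k = begin
    sum (filter (_∣? k) (List.map suc (upTo k)))
      ≤⟨ sum≤ _ (All.filter⁺ (_∣? k) (All.map⁺ (All.all-upTo k))) ⟩
    length (filter (_∣? k) (List.map suc (upTo k))) ℕ.* k
      ≤⟨ ℕ.*-monoˡ-≤ k (List.length-filter (_∣? k) (List.map suc (upTo k))) ⟩
    length (List.map suc (upTo k)) ℕ.* k
      ≡⟨ cong (ℕ._* k) (trans (List.length-map suc (upTo k)) (List.length-upTo k)) ⟩
    k ℕ.* k ∎
    where
    open ℕ.≤-Reasoning
    sum≤ : ∀ xs → All (ℕ._≤ k) xs → sum xs ℕ.≤ length xs ℕ.* k
    sum≤ []       []         = z≤n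
    sum≤ (x ∷ xs) (x≤ ∷ xs≤) = ℕ.+-mono-≤ x≤ (sum≤ xs xs≤)

  -- The coefficient of the value `j + 1` steps back in the recurrence for `c`. The sign there has
  -- exponent `j + 2`, which differs from `j` by an even number.
  σ-sign : ℕ → ℤ
  σ-sign j = ℤ.-1ℤ ℤ.^ j ℤ.* + σ (2 ℕ.+ j)

  c-dot : ∀ n → c (suc n) ≡ dotℤ σ-sign (history c (suc n))
  c-dot n = trans (c-rec (suc n) (s≤s z≤n))
    (trans (MonoidSum.sum-cong-≗ ℤ.+-0-monoid {n = suc n} λ k →
              cong (ℤ._* c (toℕ k)) (coeff≡ (toℕ k) (ℕ.≤-pred (Fin.toℕ<n k))))
           (convolution≡dotℤ σ-sign c (suc n)))
    where
    cancel : ∀ p → ℤ.-1ℤ ℤ.* (ℤ.-1ℤ ℤ.* p) ≡ p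
    cancel = solve-∀
    coeff≡ : ∀ k → k ℕ.≤ n → ℤ.-1ℤ ℤ.^ (suc n ∸ k ℕ.+ 1) ℤ.* + σ (suc n ∸ k ℕ.+ 1) ≡ σ-sign (n ∸ k)
    coeff≡ k k≤n rewrite ℕ.+-∸-assoc 1 k≤n | ℕ.+-comm (n ∸ k) 1 =
      cong (ℤ._* + σ (2 ℕ.+ (n ∸ k))) (cancel (ℤ.-1ℤ ℤ.^ (n ∸ k)))

  recurrence-coeff : ℕ → ℤ
  recurrence-coeff j = σ-sign (2 ℕ.+ j) ℤ.+ σ-sign (1 ℕ.+ j) ℤ.- σ-sign j

  -- The recurrence for `c (3 + n)`, plus the one for `c (2 + n)`, minus the one for `c (1 + n)`:
  -- this is the multiplication of the denominator by 1 + x - x². The coefficient of `c (2 + n)`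
  -- drops from 3 to 2, and that of `c (1 + n)` cancels as -4 + 3 + 1 = 0.
  c-recurrence : ∀ n → c (3 ℕ.+ n) ≡ + 2 ℤ.* c (2 ℕ.+ n) ℤ.+ dotℤ recurrence-coeff (history c (1 ℕ.+ n))
  c-recurrence n = combine (c (3 ℕ.+ n)) (c (2 ℕ.+ n)) (c (1 ℕ.+ n)) _ _ _ _
    (c-dot (2 ℕ.+ n)) (c-dot (1 ℕ.+ n)) (c-dot n)
    (dotℤ-combine (λ j → σ-sign (2 ℕ.+ j)) (λ j → σ-sign (1 ℕ.+ j)) σ-sign (history c (1 ℕ.+ n)))
    where
    algebra : ∀ y z d₂ d₁ d₀ → + 3 ℤ.* y ℤ.+ (-[1+ 3 ] ℤ.* z ℤ.+ d₂) ≡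
      + 2 ℤ.* y ℤ.+ (d₂ ℤ.+ d₁ ℤ.- d₀) ℤ.+ ((y ℤ.- (+ 3 ℤ.* z ℤ.+ d₁)) ℤ.- (z ℤ.- d₀))
    algebra = solve-∀
    combine : ∀ x y z d₂ d₁ d₀ e → x ≡ + 3 ℤ.* y ℤ.+ (-[1+ 3 ] ℤ.* z ℤ.+ d₂) → y ≡ + 3 ℤ.* z ℤ.+ d₁ → z ≡ d₀ →
      e ≡ d₂ ℤ.+ d₁ ℤ.- d₀ → x ≡ + 2 ℤ.* y ℤ.+ e
    combine x y z d₂ d₁ d₀ e x≡ y≡ z≡ e≡ rewrite x≡ | e≡ = trans (algebra y z d₂ d₁ d₀)
      (trans (cong (λ u → + 2 ℤ.* y ℤ.+ (d₂ ℤ.+ d₁ ℤ.- d₀) ℤ.+ u) (cong₂ ℤ._-_ (ℤ.i≡j⇒i-j≡0 y≡) (ℤ.i≡j⇒i-j≡0 z≡)))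
             (ℤ.+-identityʳ _))

  ≤-by : ∀ {i j k} → j ≡ i ℤ.+ k → ℤ.0ℤ ℤ.≤ k → i ℤ.≤ j
  ≤-by {i} refl 0≤k = ℤ.≤-trans (ℤ.≤-reflexive (sym (ℤ.+-identityʳ i))) (ℤ.+-monoʳ-≤ i 0≤k)

  0≤+ : ∀ {i j} → ℤ.0ℤ ℤ.≤ i → ℤ.0ℤ ℤ.≤ j → ℤ.0ℤ ℤ.≤ i ℤ.+ j
  0≤+ = ℤ.+-mono-≤

  0≤* : ∀ i j → ℤ.0ℤ ℤ.≤ i → ℤ.0ℤ ℤ.≤ j → ℤ.0ℤ ℤ.≤ i ℤ.* j
  0≤* (+ m) (+ n) _ _ = ℤ.≤-trans (ℤ.+≤+ z≤n) (ℤ.≤-reflexive (ℤ.pos-* m n))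

  Growth : ℤ → ℤ → Set
  Growth x y = ℤ.0ℤ ℤ.≤ y × + 3 ℤ.* y ℤ.≤ + 2 ℤ.* x

  -- The terms of growing lists shrink by 2/3: the multiple p m of a term covers 3/2 p m times the next one.
  horner : ∀ p f → (∀ m → ℤ.0ℤ ℤ.≤ p m) → (∀ m → + 2 ℤ.* p (suc m) ℤ.≤ + 3 ℤ.* p m ℤ.+ + 2 ℤ.* f m) →
    ∀ x xs → ℤ.0ℤ ℤ.≤ x → Linked Growth (x ∷ xs) → ℤ.0ℤ ℤ.≤ p 0 ℤ.* x ℤ.+ dotℤ f xs
  horner p f 0≤p step x []       0≤x _ = 0≤+ (0≤* (p 0) x (0≤p 0) 0≤x) ℤ.≤-refl
  horner p f 0≤p step x (y ∷ xs) 0≤x ((0≤y , 3y≤2x) ∷ growth) =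
    ℤ.*-cancelˡ-≤-pos ℤ.0ℤ _ (+ 2) (≤-by (algebra (p 0) (p 1) (f 0) x y (dotℤ (f ∘ suc) xs))
      (0≤+ (0≤+ (0≤* (p 0) _ (0≤p 0) (ℤ.i≤j⇒0≤j-i 3y≤2x)) (0≤* _ y (ℤ.i≤j⇒0≤j-i (step 0)) 0≤y))
           (0≤* (+ 2) _ (ℤ.+≤+ z≤n) (horner (p ∘ suc) (f ∘ suc) (0≤p ∘ suc) (step ∘ suc) y xs 0≤y growth))))
    where
    algebra : ∀ p₀ p₁ f₀ x y d → + 2 ℤ.* (p₀ ℤ.* x ℤ.+ (f₀ ℤ.* y ℤ.+ d)) ≡
      ℤ.0ℤ ℤ.+ (p₀ ℤ.* (+ 2 ℤ.* x ℤ.- + 3 ℤ.* y) ℤ.+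
                (+ 3 ℤ.* p₀ ℤ.+ + 2 ℤ.* f₀ ℤ.- + 2 ℤ.* p₁) ℤ.* y ℤ.+ + 2 ℤ.* (p₁ ℤ.* y ℤ.+ d))
    algebra = solve-∀

  ∣i∣≤n⇒0≤i+n : ∀ i n → ℤ.∣ i ∣ ℕ.≤ n → ℤ.0ℤ ℤ.≤ i ℤ.+ + n
  ∣i∣≤n⇒0≤i+n (+ _)    _ _   = ℤ.+≤+ z≤n
  ∣i∣≤n⇒0≤i+n -[1+ _ ] _ m<n = subst (ℤ.0ℤ ℤ.≤_) (sym (ℤ.⊖-≥ m<n)) (ℤ.+≤+ z≤n)

  ∣σ-sign∣ : ∀ j → ℤ.∣ σ-sign j ∣ ≡ σ (2 ℕ.+ j)
  ∣σ-sign∣ j = trans (ℤ.abs-* (ℤ.-1ℤ ℤ.^ j) _)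
    (trans (cong (ℕ._* σ (2 ℕ.+ j)) (∣-1^∣ j)) (ℕ.*-identityˡ _))
    where
    ∣-1^∣ : ∀ j → ℤ.∣ ℤ.-1ℤ ℤ.^ j ∣ ≡ 1
    ∣-1^∣ zero    = refl
    ∣-1^∣ (suc j) = trans (ℤ.abs-* ℤ.-1ℤ (ℤ.-1ℤ ℤ.^ j)) (trans (ℕ.*-identityˡ _) (∣-1^∣ j))

  -- Triangle inequality: the coefficient consists of three values of σ up to sign, at arguments at
  -- most m + 4, each bounded by (m + 4)².
  -3[m+4]²≤recurrence-coeff : ∀ m → ℤ.0ℤ ℤ.≤ recurrence-coeff m ℤ.+ + 3 ℤ.* (+ (4 ℕ.+ m) ℤ.* + (4 ℕ.+ m))
  -3[m+4]²≤recurrence-coeff m =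
    subst (λ u → ℤ.0ℤ ℤ.≤ recurrence-coeff m ℤ.+ u) (ℤ.pos-* 3 s) (∣i∣≤n⇒0≤i+n (recurrence-coeff m) (3 ℕ.* s) (begin
    ℤ.∣ σ-sign (2 ℕ.+ m) ℤ.+ σ-sign (1 ℕ.+ m) ℤ.- σ-sign m ∣
      ≤⟨ ℤ.∣i-j∣≤∣i∣+∣j∣ (σ-sign (2 ℕ.+ m) ℤ.+ σ-sign (1 ℕ.+ m)) (σ-sign m) ⟩
    ℤ.∣ σ-sign (2 ℕ.+ m) ℤ.+ σ-sign (1 ℕ.+ m) ∣ ℕ.+ ℤ.∣ σ-sign m ∣
      ≤⟨ ℕ.+-mono-≤ (ℤ.∣i+j∣≤∣i∣+∣j∣ (σ-sign (2 ℕ.+ m)) (σ-sign (1 ℕ.+ m))) (bound 0 z≤n) ⟩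
    ℤ.∣ σ-sign (2 ℕ.+ m) ∣ ℕ.+ ℤ.∣ σ-sign (1 ℕ.+ m) ∣ ℕ.+ s
      ≤⟨ ℕ.+-monoˡ-≤ s (ℕ.+-mono-≤ (bound 2 ℕ.≤-refl) (bound 1 (s≤s z≤n))) ⟩
    s ℕ.+ s ℕ.+ s
      ≡⟨ thrice s ⟩
    3 ℕ.* s ∎))
    where
    open ℕ.≤-Reasoning
    s : ℕ
    s = (4 ℕ.+ m) ℕ.* (4 ℕ.+ m)
    thrice : ∀ s → s ℕ.+ s ℕ.+ s ≡ 3 ℕ.* s
    thrice = ℕ-Solver.solve-∀
    bound : ∀ i → i ℕ.≤ 2 → ℤ.∣ σ-sign (i ℕ.+ m) ∣ ℕ.≤ s
    bound i i≤2 = begin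
      ℤ.∣ σ-sign (i ℕ.+ m) ∣                 ≡⟨ ∣σ-sign∣ (i ℕ.+ m) ⟩
      σ (2 ℕ.+ (i ℕ.+ m))                    ≤⟨ σ≤square (2 ℕ.+ (i ℕ.+ m)) ⟩
      (2 ℕ.+ (i ℕ.+ m)) ℕ.* (2 ℕ.+ (i ℕ.+ m)) ≤⟨ ℕ.*-mono-≤ le le ⟩
      s                                      ∎
      where
      le : 2 ℕ.+ (i ℕ.+ m) ℕ.≤ 4 ℕ.+ m
      le = s≤s (s≤s (ℕ.+-monoˡ-≤ m i≤2))

  prepend : List ℕ → (ℕ → ℤ) → ℕ → ℤ
  prepend []       g m       = g m
  prepend (x ∷ xs) g zero    = + x
  prepend (x ∷ xs) g (suc m) = prepend xs (g ∘ suc) m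

  0≤prepend : ∀ xs g → (∀ m → ℤ.0ℤ ℤ.≤ g m) → ∀ m → ℤ.0ℤ ℤ.≤ prepend xs g m
  0≤prepend []       g 0≤g m       = 0≤g m
  0≤prepend (x ∷ xs) g 0≤g zero    = ℤ.+≤+ z≤n
  0≤prepend (x ∷ xs) g 0≤g (suc m) = 0≤prepend xs (g ∘ suc) (0≤g ∘ suc) m

  prepend-beyond : ∀ xs g m → length xs ℕ.≤ m → prepend xs g m ≡ g m
  prepend-beyond []       g m       _         = refl
  prepend-beyond (x ∷ xs) g (suc m) (s≤s l≤m) = prepend-beyond xs (g ∘ suc) m l≤m

  -- The table is the orbit of p ↦ 4 f(m) + ⌊3p/2⌋ for the recurrence coefficients f, started at 3; from
  -- m = 16 on it has outgrown 32 (m+4)², which absorbs the bound f(m) ≥ -3 (m+4)² at every later step.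
  weight-table : List ℕ
  weight-table = 3 ∷ 4 ∷ 26 ∷ 35 ∷ 92 ∷ 118 ∷ 217 ∷ 285 ∷ 503 ∷ 746 ∷ 1223 ∷ 1762 ∷ 2699 ∷ 3980 ∷ 6118 ∷ 9137 ∷ []

  weight : ℕ → ℤ
  weight = prepend weight-table λ m → + 32 ℤ.* (+ (4 ℕ.+ m) ℤ.* + (4 ℕ.+ m))

  weight-≥16 : ∀ m → 16 ℕ.≤ m → weight m ≡ + 32 ℤ.* (+ (4 ℕ.+ m) ℤ.* + (4 ℕ.+ m))
  weight-≥16 m = prepend-beyond weight-table _ m

  0≤weight : ∀ m → ℤ.0ℤ ℤ.≤ weight m
  0≤weight = 0≤prepend weight-table _ λ m →
    0≤* (+ 32) _ (ℤ.+≤+ z≤n) (0≤* (+ (4 ℕ.+ m)) (+ (4 ℕ.+ m)) (ℤ.+≤+ z≤n) (ℤ.+≤+ z≤n))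

  WeightStep : ℕ → Set
  WeightStep m = + 2 ℤ.* weight (suc m) ℤ.≤ + 3 ℤ.* weight m ℤ.+ + 2 ℤ.* (+ 4 ℤ.* recurrence-coeff m)

  -- Of the available 96 s, the share 24 s pays for 8 f ≥ -24 s, and the remaining 72 s covers 64 t.
  -- Here `s` and `t` stand for consecutive squares.
  absorb : ∀ f s t → + 64 ℤ.* t ℤ.≤ + 72 ℤ.* s → ℤ.0ℤ ℤ.≤ f ℤ.+ + 3 ℤ.* s →
    + 2 ℤ.* (+ 32 ℤ.* t) ℤ.≤ + 3 ℤ.* (+ 32 ℤ.* s) ℤ.+ + 2 ℤ.* (+ 4 ℤ.* f)
  absorb f s t 64t≤72s 0≤f+3s = ≤-by (algebra f s t)
    (0≤+ (0≤* (+ 8) _ (ℤ.+≤+ z≤n) 0≤f+3s) (ℤ.i≤j⇒0≤j-i 64t≤72s))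
    where
    algebra : ∀ f s t → + 3 ℤ.* (+ 32 ℤ.* s) ℤ.+ + 2 ℤ.* (+ 4 ℤ.* f) ≡
      + 2 ℤ.* (+ 32 ℤ.* t) ℤ.+ (+ 8 ℤ.* (f ℤ.+ + 3 ℤ.* s) ℤ.+ (+ 72 ℤ.* s ℤ.- + 64 ℤ.* t))
    algebra = solve-∀

  -- The difference of the two sides is 8 (j - 20)(j + 4) + 576. The threshold 20 is m + 4 at m =
  -- 16, where the table ends.
  64[1+j]²≤72j² : ∀ j → + 20 ℤ.≤ j → + 64 ℤ.* ((+ 1 ℤ.+ j) ℤ.* (+ 1 ℤ.+ j)) ℤ.≤ + 72 ℤ.* (j ℤ.* j)
  64[1+j]²≤72j² j 20≤j = ≤-by (algebra j)
    (0≤+ (0≤* (+ 8) _ (ℤ.+≤+ z≤n) (0≤* (j ℤ.- + 20) _ 0≤j-20 (0≤+ 0≤j-20 (ℤ.+≤+ {0} {24} z≤n)))) (ℤ.+≤+ {0} {576} z≤n))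
    where
    0≤j-20 : ℤ.0ℤ ℤ.≤ j ℤ.- + 20
    0≤j-20 = ℤ.i≤j⇒0≤j-i 20≤j
    algebra : ∀ j → + 72 ℤ.* (j ℤ.* j) ≡ + 64 ℤ.* ((+ 1 ℤ.+ j) ℤ.* (+ 1 ℤ.+ j)) ℤ.+
      (+ 8 ℤ.* ((j ℤ.- + 20) ℤ.* ((j ℤ.- + 20) ℤ.+ + 24)) ℤ.+ + 576)
    algebra = solve-∀

  weight-step-≥16 : ∀ m → 16 ℕ.≤ m → WeightStep m
  weight-step-≥16 m 16≤m = subst₂ (λ u v → + 2 ℤ.* u ℤ.≤ + 3 ℤ.* v ℤ.+ + 2 ℤ.* (+ 4 ℤ.* recurrence-coeff m))
    (sym (weight-≥16 (suc m) (ℕ.m≤n⇒m≤1+n 16≤m))) (sym (weight-≥16 m 16≤m))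
    (absorb (recurrence-coeff m) (+ (4 ℕ.+ m) ℤ.* + (4 ℕ.+ m)) (+ (5 ℕ.+ m) ℤ.* + (5 ℕ.+ m))
      (64[1+j]²≤72j² (+ (4 ℕ.+ m)) (ℤ.+≤+ (ℕ.+-monoʳ-≤ 4 16≤m))) (-3[m+4]²≤recurrence-coeff m))

  weight-step : ∀ m → WeightStep m
  weight-step m with m ℕ.<? 16
  -- The first 16 cases are decided by evaluation. They include m = 15, where the step passes from
  -- the table to the quadratic weights.
  ... | yes m<16 = subst WeightStep (Fin.toℕ-fromℕ< m<16)
                     (from-yes (Fin.all? λ (i : Fin 16) → step? (toℕ i)) (Fin.fromℕ< m<16))
    where
    step? : ∀ m → Dec (WeightStep m)
    step? m = + 2 ℤ.* weight (suc m) ℤ.≤? + 3 ℤ.* weight m ℤ.+ + 2 ℤ.* (+ 4 ℤ.* recurrence-coeff m)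
  ... | no m≮16 = weight-step-≥16 m (ℕ.≮⇒≥ m≮16)

  -- With y, z the two preceding values and d the remaining dot product, 4 c(n+3) = 8y + 4d = 6y +
  -- (2y - 3z) + (3z + 4d). The first bracket is nonnegative by induction, the second by `horner`;
  -- this is why the weights start at 3 and refer to four times the recurrence coefficients.
  -- Positivity of the new value then follows from that of y.
  c-growth : ∀ n → Linked Growth (history c (suc n)) × ℤ.0ℤ ℤ.< c n
  c-growth 0 = [-] , ℤ.+<+ (s≤s z≤n)
  c-growth 1 = (ℤ.+≤+ z≤n , from-yes (+ 3 ℤ.* c 0 ℤ.≤? + 2 ℤ.* c 1)) ∷ [-] , from-yes (ℤ.0ℤ ℤ.<? c 1)
  c-growth 2 = (ℤ.+≤+ z≤n , from-yes (+ 3 ℤ.* c 1 ℤ.≤? + 2 ℤ.* c 2)) ∷ proj₁ (c-growth 1) , from-yes (ℤ.0ℤ ℤ.<? c 2)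
  c-growth (suc (suc (suc n))) with c-growth (suc (suc n))
  ... | (_,_ 0≤z 3z≤2y) ∷ growth , 0<y = (ℤ.<⇒≤ 0<y , 3y≤2x) ∷ (0≤z , 3z≤2y) ∷ growth ,
    ℤ.*-cancelˡ-<-nonNeg (+ 2) (ℤ.<-≤-trans (ℤ.*-monoˡ-<-pos (+ 3) 0<y) 3y≤2x)
    where
    y z : ℤ
    y = c (2 ℕ.+ n)
    z = c (1 ℕ.+ n)
    algebra : ∀ y z d → + 2 ℤ.* (+ 2 ℤ.* (+ 2 ℤ.* y ℤ.+ d)) ≡
      + 2 ℤ.* (+ 3 ℤ.* y) ℤ.+ ((+ 2 ℤ.* y ℤ.- + 3 ℤ.* z) ℤ.+ (+ 3 ℤ.* z ℤ.+ + 4 ℤ.* d))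
    algebra = solve-∀
    3y≤2x : + 3 ℤ.* y ℤ.≤ + 2 ℤ.* c (3 ℕ.+ n)
    3y≤2x = subst (λ x → + 3 ℤ.* y ℤ.≤ + 2 ℤ.* x) (sym (c-recurrence n))
      (ℤ.*-cancelˡ-≤-pos (+ 3 ℤ.* y) _ (+ 2) (≤-by (algebra y z _)
        (0≤+ (ℤ.i≤j⇒0≤j-i 3z≤2y)
             (subst (λ d → ℤ.0ℤ ℤ.≤ + 3 ℤ.* z ℤ.+ d) (dotℤ-scale (+ 4) recurrence-coeff (history c (1 ℕ.+ n)))
               (horner weight (λ m → + 4 ℤ.* recurrence-coeff m) 0≤weight weight-step z _ 0≤z growth)))))

  0<c : ∀ n → ℤ.0ℤ ℤ.< c n
  0<c n = proj₂ (c-growth n)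

open Positivity using (0<c)

-- The homomorphism from the integers to a commutative ring.

-- The ring solver needs coefficients with decidable equality: ℤ maps to every commutative ring.
module IntegerCoefficients {a ℓ} (R : CommutativeRing a ℓ) where
  open CommutativeRing R
  open Mult semiring using (×1-homo-*; ×-homo-+; 1+×) renaming (_×_ to _·_)
  open RingProperties ring using (-0#≈0#; -‿distribˡ-*; -‿distribʳ-*; -‿involutive)
  open AbelianGroupProperties +-abelianGroup using (⁻¹-∙-comm)
  open import Relation.Binary.Reasoning.Setoid setoid

  -- With the optimised multiples, `+ 1` is sent to `1#` definitionally, so constants in solved
  -- equations appear without a stray `0#`.
  ⟦_⟧ℤ : ℤ → Carrier
  ⟦ + n ⟧ℤ      = n · 1#
  ⟦ -[1+ n ] ⟧ℤ = - (suc n · 1#)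

  ⊖-homo : ∀ m n → ⟦ m ℤ.⊖ n ⟧ℤ ≈ m · 1# - n · 1#
  ⊖-homo zero    zero    = sym (-‿inverseʳ 0#)
  ⊖-homo zero    (suc n) = sym (+-identityˡ _)
  ⊖-homo (suc m) zero    = sym (trans (+-congˡ -0#≈0#) (+-identityʳ _))
  ⊖-homo (suc m) (suc n) = begin
    ⟦ suc m ℤ.⊖ suc n ⟧ℤ                ≡⟨ cong ⟦_⟧ℤ (ℤ.[1+m]⊖[1+n]≡m⊖n m n) ⟩
    ⟦ m ℤ.⊖ n ⟧ℤ                        ≈⟨ ⊖-homo m n ⟩
    m · 1# - n · 1#                     ≈⟨ +-congʳ (+-identityˡ _) ⟨
    (0# + m · 1#) - n · 1#              ≈⟨ +-congʳ (+-congʳ (-‿inverseʳ 1#)) ⟨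
    (1# - 1# + m · 1#) - n · 1#
      ≈⟨ +-congʳ (trans (+-assoc _ _ _) (trans (+-congˡ (+-comm _ _)) (sym (+-assoc _ _ _)))) ⟩
    (1# + m · 1# - 1#) - n · 1#         ≈⟨ +-assoc _ _ _ ⟩
    (1# + m · 1#) + (- 1# - n · 1#)     ≈⟨ +-congˡ (⁻¹-∙-comm _ _) ⟩
    (1# + m · 1#) - (1# + n · 1#)       ≈⟨ +-cong (1+× m 1#) (-‿cong (1+× n 1#)) ⟨
    suc m · 1# - suc n · 1#             ∎

  +-homo : ∀ i j → ⟦ i ℤ.+ j ⟧ℤ ≈ ⟦ i ⟧ℤ + ⟦ j ⟧ℤ
  +-homo (+ m)    (+ n)    = ×-homo-+ 1# m n
  +-homo (+ m)    -[1+ n ] = ⊖-homo m (suc n)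
  +-homo -[1+ m ] (+ n)    = trans (⊖-homo n (suc m)) (+-comm _ _)
  +-homo -[1+ m ] -[1+ n ] = begin
    - (suc (suc (m ℕ.+ n)) · 1#)       ≡⟨ cong (λ k → - (k · 1#)) (ℕ.+-suc (suc m) n) ⟨
    - ((suc m ℕ.+ suc n) · 1#)         ≈⟨ -‿cong (×-homo-+ 1# (suc m) (suc n)) ⟩
    - (suc m · 1# + suc n · 1#)        ≈⟨ ⁻¹-∙-comm _ _ ⟨
    - (suc m · 1#) - suc n · 1#        ∎

  -‿homo : ∀ i → ⟦ ℤ.- i ⟧ℤ ≈ - ⟦ i ⟧ℤ
  -‿homo (+ zero)  = sym -0#≈0#
  -‿homo (+ suc n) = refl
  -‿homo -[1+ n ]  = sym (-‿involutive _)

  *-homo-pos : ∀ m j → ⟦ + m ℤ.* j ⟧ℤ ≈ m · 1# * ⟦ j ⟧ℤ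
  *-homo-pos m (+ n)    = trans (reflexive (cong ⟦_⟧ℤ (≡.sym (ℤ.pos-* m n)))) (×1-homo-* m n)
  *-homo-pos m -[1+ n ] = begin
    ⟦ + m ℤ.* -[1+ n ] ⟧ℤ         ≡⟨ cong ⟦_⟧ℤ (ℤ.neg-distribʳ-* (+ m) (+ suc n)) ⟨
    ⟦ ℤ.- (+ m ℤ.* + suc n) ⟧ℤ    ≈⟨ -‿homo (+ m ℤ.* + suc n) ⟩
    - ⟦ + m ℤ.* + suc n ⟧ℤ        ≈⟨ -‿cong (*-homo-pos m (+ suc n)) ⟩
    - (m · 1# * (suc n · 1#))     ≈⟨ -‿distribʳ-* _ _ ⟩
    m · 1# * - (suc n · 1#)       ∎

  *-homo : ∀ i j → ⟦ i ℤ.* j ⟧ℤ ≈ ⟦ i ⟧ℤ * ⟦ j ⟧ℤ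
  *-homo (+ m)    j = *-homo-pos m j
  *-homo -[1+ m ] j = begin
    ⟦ -[1+ m ] ℤ.* j ⟧ℤ           ≡⟨ cong ⟦_⟧ℤ (ℤ.neg-distribˡ-* (+ suc m) j) ⟨
    ⟦ ℤ.- (+ suc m ℤ.* j) ⟧ℤ      ≈⟨ -‿homo (+ suc m ℤ.* j) ⟩
    - ⟦ + suc m ℤ.* j ⟧ℤ          ≈⟨ -‿cong (*-homo-pos (suc m) j) ⟩
    - (suc m · 1# * ⟦ j ⟧ℤ)       ≈⟨ -‿distribˡ-* _ _ ⟩
    - (suc m · 1#) * ⟦ j ⟧ℤ       ∎

  homomorphism : CommutativeRing.rawRing ℤ.+-*-commutativeRing -Raw-AlmostCommutative⟶ fromCommutativeRing R
  homomorphism = record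
    { ⟦_⟧    = ⟦_⟧ℤ
    ; +-homo = +-homo
    ; *-homo = *-homo
    ; -‿homo = -‿homo
    ; 0-homo = refl
    ; 1-homo = refl
    }

  open RingSolver _ _ homomorphism
    (λ i j → Maybe.map (reflexive ∘ cong ⟦_⟧ℤ) (dec⇒maybe (i ℤ.≟ j))) public
    using (solve; con; _:+_; _:*_; _:-_; :-_; _:=_)

-- Arithmetic and inequalities in an ordered field.

module OrderedField (R : CompleteOrderedField) where
  open CompleteOrderedField R public
  open CommutativeRing commutativeRing public
    hiding (Carrier; _≈_; _+_; _*_; -_; 0#; 1#; isCommutativeRing)
  open IsStrictTotalOrder isStrictTotalOrder public
    using (compare; isStrictPartialOrder; <-respˡ-≈; <-respʳ-≈) renaming (trans to <-trans; irrefl to <-irrefl)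
  open IntegerCoefficients commutativeRing public using (solve; con; _:+_; _:*_; _:-_; :-_; _:=_)
  open IsTotalOrder (StrictToNonStrict.isTotalOrder _≈_ _<_ isStrictTotalOrder) public
    using () renaming (refl to ≤-refl; trans to ≤-trans; antisym to ≤-antisym; total to ≤-total)

  <-≤-trans : ∀ {x y z} → x < y → y ≤ z → x < z
  <-≤-trans = StrictToNonStrict.<-≤-trans _≈_ _<_ <-trans <-respʳ-≈

  ≤-<-trans : ∀ {x y z} → x ≤ y → y < z → x < z
  ≤-<-trans = StrictToNonStrict.≤-<-trans _≈_ _<_ sym <-trans <-respˡ-≈

  strictPartialOrder : StrictPartialOrder _ _ _
  strictPartialOrder = record { isStrictPartialOrder = isStrictPartialOrder }

  module ≤-Reasoning = StrictPartialOrderReasoning strictPartialOrder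

  <⇒≱ : ∀ {x y} → x < y → ¬ y ≤ x
  <⇒≱ x<y y≤x = <-irrefl refl (<-≤-trans x<y y≤x)

  ≮⇒≥ : ∀ {x y} → ¬ x < y → y ≤ x
  ≮⇒≥ {x} {y} x≮y with compare x y
  ... | tri< x<y _ _ = contradiction x<y x≮y
  ... | tri≈ _ x≈y _ = inj₂ (sym x≈y)
  ... | tri> _ _ y<x = inj₁ y<x

  ≰⇒> : ∀ {x y} → ¬ x ≤ y → y < x
  ≰⇒> {x} {y} x≰y with compare x y
  ... | tri< x<y _ _ = contradiction (inj₁ x<y) x≰y
  ... | tri≈ _ x≈y _ = contradiction (inj₂ x≈y) x≰y
  ... | tri> _ _ y<x = y<x

  upper-bound : ∀ x y → ∃[ z ] x ≤ z × y ≤ z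
  upper-bound x y with ≤-total x y
  ... | inj₁ x≤y = y , x≤y , ≤-refl
  ... | inj₂ y≤x = x , ≤-refl , y≤x

  <-by : ∀ {x y d} → y ≈ x + d → 0# < d → x < y
  <-by {x} {y} {d} y≈x+d 0<d = <-respʳ-≈ (trans (+-comm d x) (sym y≈x+d)) (<-respˡ-≈ (+-identityˡ x) (+-monoˡ-< x 0<d))

  ≤-by : ∀ {x y d} → y ≈ x + d → 0# ≤ d → x ≤ y
  ≤-by y≈x+d (inj₁ 0<d) = inj₁ (<-by y≈x+d 0<d)
  ≤-by y≈x+d (inj₂ 0≈d) = inj₂ (sym (trans y≈x+d (trans (+-congˡ (sym 0≈d)) (+-identityʳ _))))

  x<y⇒0<y-x : ∀ {x y} → x < y → 0# < y - x
  x<y⇒0<y-x {x} x<y = <-respˡ-≈ (-‿inverseʳ x) (+-monoˡ-< (- x) x<y)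

  x≤y⇒0≤y-x : ∀ {x y} → x ≤ y → 0# ≤ y - x
  x≤y⇒0≤y-x (inj₁ x<y) = inj₁ (x<y⇒0<y-x x<y)
  x≤y⇒0≤y-x {x} {y} (inj₂ x≈y) = inj₂ (sym (trans (+-congʳ (sym x≈y)) (-‿inverseʳ x)))

  0<+ : ∀ {x y} → 0# < x → 0# < y → 0# < x + y
  0<+ 0<x 0<y = <-trans 0<x (<-by refl 0<y)

  0<+0≤ : ∀ {x y} → 0# < x → 0# ≤ y → 0# < x + y
  0<+0≤ 0<x 0≤y = <-≤-trans 0<x (≤-by refl 0≤y)

  0≤+ : ∀ {x y} → 0# ≤ x → 0# ≤ y → 0# ≤ x + y
  0≤+ 0≤x 0≤y = ≤-trans 0≤x (≤-by refl 0≤y)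

  0≤* : ∀ {x y} → 0# ≤ x → 0# ≤ y → 0# ≤ x * y
  0≤* (inj₁ 0<x) (inj₁ 0<y) = inj₁ (*-pos 0<x 0<y)
  0≤* (inj₁ 0<x) (inj₂ 0≈y) = inj₂ (sym (trans (*-congˡ (sym 0≈y)) (zeroʳ _)))
  0≤* (inj₂ 0≈x) _          = inj₂ (sym (trans (*-congʳ (sym 0≈x)) (zeroˡ _)))

  0≤x*x : ∀ x → 0# ≤ x * x
  0≤x*x x with compare x 0#
  ... | tri< x<0 _ _ = inj₁ (<-respʳ-≈ (solve 1 (λ x → (con (+ 0) :- x) :* (con (+ 0) :- x) := x :* x) refl x)
                              (*-pos (x<y⇒0<y-x x<0) (x<y⇒0<y-x x<0)))
  ... | tri≈ _ x≈0 _ = inj₂ (sym (trans (*-congʳ x≈0) (zeroˡ _)))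
  ... | tri> _ _ 0<x = inj₁ (*-pos 0<x 0<x)

  0<1 : 0# < 1#
  0<1 with 0≤x*x 1#
  ... | inj₁ 0<1*1 = <-respʳ-≈ (*-identityʳ 1#) 0<1*1
  ... | inj₂ 0≈1*1 = contradiction (trans (sym (*-identityʳ 1#)) (sym 0≈1*1)) 1≉0

  +-mono-≤ : ∀ {w x y z} → w ≤ x → y ≤ z → w + y ≤ x + z
  +-mono-≤ {w} {x} {y} {z} w≤x y≤z = ≤-by
    (solve 4 (λ w x y z → x :+ z := (w :+ y) :+ ((x :- w) :+ (z :- y))) refl w x y z)
    (0≤+ (x≤y⇒0≤y-x w≤x) (x≤y⇒0≤y-x y≤z))

  *-monoˡ-≤ : ∀ {k x y} → 0# ≤ k → x ≤ y → k * x ≤ k * y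
  *-monoˡ-≤ {k} {x} {y} 0≤k x≤y = ≤-by (solve 3 (λ k x y → k :* y := k :* x :+ k :* (y :- x)) refl k x y)
    (0≤* 0≤k (x≤y⇒0≤y-x x≤y))

  *-monoˡ-< : ∀ {k x y} → 0# < k → x < y → k * x < k * y
  *-monoˡ-< {k} {x} {y} 0<k x<y = <-by (solve 3 (λ k x y → k :* y := k :* x :+ k :* (y :- x)) refl k x y)
    (*-pos 0<k (x<y⇒0<y-x x<y))

  *-mono-≤ : ∀ {w x y z} → 0# ≤ x → 0# ≤ y → w ≤ x → y ≤ z → w * y ≤ x * z
  *-mono-≤ {w} {x} {y} {z} 0≤x 0≤y w≤x y≤z = ≤-by
    (solve 4 (λ w x y z → x :* z := w :* y :+ ((x :- w) :* y :+ x :* (z :- y))) refl w x y z)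
    (0≤+ (0≤* (x≤y⇒0≤y-x w≤x) 0≤y) (0≤* 0≤x (x≤y⇒0≤y-x y≤z)))

  *-cancelˡ-≤ : ∀ {k x y} → 0# < k → k * x ≤ k * y → x ≤ y
  *-cancelˡ-≤ 0<k kx≤ky = ≮⇒≥ λ y<x → <⇒≱ (*-monoˡ-< 0<k y<x) kx≤ky

  *-cancelˡ-< : ∀ {k x y} → 0# ≤ k → k * x < k * y → x < y
  *-cancelˡ-< 0≤k kx<ky = ≰⇒> λ y≤x → <⇒≱ kx<ky (*-monoˡ-≤ 0≤k y≤x)

  square-cancel-≤ : ∀ {x y} → 0# ≤ y → x * x ≤ y * y → x ≤ y
  square-cancel-≤ {x} {y} 0≤y x²≤y² = ≮⇒≥ λ y<x → <⇒≱
    (<-by (solve 2 (λ x y → x :* x := y :* y :+ (x :- y) :* (x :- y :+ (y :+ y))) refl x y)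
      (*-pos (x<y⇒0<y-x y<x) (0<+0≤ (x<y⇒0<y-x y<x) (0≤+ 0≤y 0≤y)))) x²≤y²

  reciprocal : ∀ {x} → 0# < x → ∃[ y ] x * y ≈ 1# × 0# < y
  reciprocal {x} 0<x with inverse x (λ x≈0 → <-irrefl (sym x≈0) 0<x)
  ... | y , xy≈1 = y , xy≈1 , *-cancelˡ-< (inj₁ 0<x) (<-respˡ-≈ (sym (zeroʳ x)) (<-respʳ-≈ (sym xy≈1) 0<1))

  quotient : ∀ x {y} → 0# < y → ∃[ q ] y * q ≈ x
  quotient x {y} 0<y with reciprocal 0<y
  ... | r , yr≈1 , _ = r * x , trans (sym (*-assoc y r x)) (trans (*-congʳ yr≈1) (*-identityˡ x))

  infix 4 ∣_∣≤_

  ∣_∣≤_ : Carrier → Carrier → Set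
  ∣ x ∣≤ b = x ≤ b × - x ≤ b

  ∣∣≤-cong : ∀ {x y b} → x ≈ y → ∣ x ∣≤ b → ∣ y ∣≤ b
  ∣∣≤-cong x≈y (x≤b , -x≤b) = ≤-trans (inj₂ (sym x≈y)) x≤b , ≤-trans (inj₂ (-‿cong (sym x≈y))) -x≤b

  ∣∣≤-relax : ∀ {x b c} → b ≤ c → ∣ x ∣≤ b → ∣ x ∣≤ c
  ∣∣≤-relax b≤c (x≤b , -x≤b) = ≤-trans x≤b b≤c , ≤-trans -x≤b b≤c

  ∣∣≤-+ : ∀ {x y b c} → ∣ x ∣≤ b → ∣ y ∣≤ c → ∣ x + y ∣≤ b + c
  ∣∣≤-+ {x} {y} (x≤b , -x≤b) (y≤c , -y≤c) = +-mono-≤ x≤b y≤c ,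
    ≤-trans (inj₂ (solve 2 (λ x y → :- (x :+ y) := :- x :+ :- y) refl x y)) (+-mono-≤ -x≤b -y≤c)

  ∣∣≤-neg : ∀ {x b} → ∣ x ∣≤ b → ∣ - x ∣≤ b
  ∣∣≤-neg {x} (x≤b , -x≤b) = -x≤b , ≤-trans (inj₂ (solve 1 (λ x → :- (:- x) := x) refl x)) x≤b

  ∣∣≤-scale : ∀ {k x b} → 0# ≤ k → ∣ x ∣≤ b → ∣ k * x ∣≤ k * b
  ∣∣≤-scale {k} {x} 0≤k (x≤b , -x≤b) = *-monoˡ-≤ 0≤k x≤b ,
    ≤-trans (inj₂ (solve 2 (λ k x → :- (k :* x) := k :* :- x) refl k x)) (*-monoˡ-≤ 0≤k -x≤b)

  -- Lipschitz functions and the intermediate value theorem.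

  -- A quantitative substitute for continuity on the interval from 0 to `B`. The bound on `f` is
  -- carried along because the product with x needs it; one constant serves both purposes, and its
  -- positivity allows division by it.
  record LipschitzOn (B : Carrier) (f : Carrier → Carrier) : Set where
    field
      K         : Carrier
      0<K       : 0# < K
      bounded   : ∀ x → 0# ≤ x → x ≤ B → ∣ f x ∣≤ K
      lipschitz : ∀ x y → 0# ≤ x → x ≤ y → y ≤ B → ∣ f y - f x ∣≤ K * (y - x)

  open LipschitzOn

  lipschitz-constant : ∀ B c → ∣ c ∣≤ 1# → LipschitzOn B (λ _ → c)
  lipschitz-constant B c ∣c∣≤1 = record
    { K         = 1#
    ; 0<K       = 0<1
    ; bounded   = λ _ _ _ → ∣c∣≤1
    ; lipschitz = λ x y 0≤x x≤y y≤B → let 0≤ = 0≤* (inj₁ 0<1) (x≤y⇒0≤y-x x≤y) in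
        ≤-trans (inj₂ (-‿inverseʳ c)) 0≤ , ≤-trans (inj₂ (solve 1 (λ c → :- (c :- c) := con (+ 0)) refl c)) 0≤
    }

  lipschitz-sub : ∀ {B f g} → LipschitzOn B f → LipschitzOn B g → LipschitzOn B (λ x → f x - g x)
  lipschitz-sub {B} {f} {g} F G = record
    { K         = K F + K G
    ; 0<K       = 0<+ (0<K F) (0<K G)
    ; bounded   = λ x 0≤x x≤B → ∣∣≤-+ (bounded F x 0≤x x≤B) (∣∣≤-neg (bounded G x 0≤x x≤B))
    ; lipschitz = λ x y 0≤x x≤y y≤B → ∣∣≤-relax (inj₂ (sym (distribʳ _ _ _)))
        (∣∣≤-cong (solve 4 (λ fx fy gx gy → (fy :- fx) :+ :- (gy :- gx) := (fy :- gy) :- (fx :- gx)) refl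
                     (f x) (f y) (g x) (g y))
          (∣∣≤-+ (lipschitz F x y 0≤x x≤y y≤B) (∣∣≤-neg (lipschitz G x y 0≤x x≤y y≤B))))
    }

  lipschitz-scale : ∀ {B f k} → 0# < k → LipschitzOn B f → LipschitzOn B (λ x → k * f x)
  lipschitz-scale {B} {f} {k} 0<k F = record
    { K         = k * K F
    ; 0<K       = *-pos 0<k (0<K F)
    ; bounded   = λ x 0≤x x≤B → ∣∣≤-scale (inj₁ 0<k) (bounded F x 0≤x x≤B)
    ; lipschitz = λ x y 0≤x x≤y y≤B → ∣∣≤-relax (inj₂ (sym (*-assoc _ _ _)))
        (∣∣≤-cong (solve 3 (λ k fx fy → k :* (fy :- fx) := k :* fy :- k :* fx) refl k (f x) (f y))
          (∣∣≤-scale (inj₁ 0<k) (lipschitz F x y 0≤x x≤y y≤B)))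
    }

  lipschitz-+ : ∀ {B f g} → LipschitzOn B f → LipschitzOn B g → LipschitzOn B (λ x → f x + g x)
  lipschitz-+ {B} {f} {g} F G = record
    { K         = K F + K G
    ; 0<K       = 0<+ (0<K F) (0<K G)
    ; bounded   = λ x 0≤x x≤B → ∣∣≤-+ (bounded F x 0≤x x≤B) (bounded G x 0≤x x≤B)
    ; lipschitz = λ x y 0≤x x≤y y≤B → ∣∣≤-relax (inj₂ (sym (distribʳ _ _ _)))
        (∣∣≤-cong (solve 4 (λ fx fy gx gy → (fy :- fx) :+ (gy :- gx) := (fy :+ gy) :- (fx :+ gx)) refl
                     (f x) (f y) (g x) (g y))
          (∣∣≤-+ (lipschitz F x y 0≤x x≤y y≤B) (lipschitz G x y 0≤x x≤y y≤B)))
    }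

  -- Product rule y f(y) - x f(x) = y (f(y) - f(x)) + (y - x) f(x), whose two terms contribute B K
  -- and K to the constant.
  lipschitz-id* : ∀ {B f} → 0# < B → LipschitzOn B f → LipschitzOn B (λ x → x * f x)
  lipschitz-id* {B} {f} 0<B F = record
    { K         = B * K F + K F
    ; 0<K       = 0<+ (*-pos 0<B (0<K F)) (0<K F)
    ; bounded   = λ x 0≤x x≤B → ∣∣≤-relax
        (≤-trans (*-mono-≤ (inj₁ 0<B) (inj₁ (0<K F)) x≤B ≤-refl) (≤-by refl (inj₁ (0<K F))))
        (∣∣≤-scale 0≤x (bounded F x 0≤x x≤B))
    ; lipschitz = λ x y 0≤x x≤y y≤B → let 0≤y-x = x≤y⇒0≤y-x x≤y in
        ∣∣≤-relax (≤-trans (+-mono-≤ (*-mono-≤ (inj₁ 0<B) (0≤* (inj₁ (0<K F)) 0≤y-x) y≤B ≤-refl) ≤-refl)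
          (inj₂ (solve 4 (λ b k x y → b :* (k :* (y :- x)) :+ (y :- x) :* k := (b :* k :+ k) :* (y :- x))
                   refl B (K F) x y)))
        (∣∣≤-cong (solve 4 (λ x y fx fy → y :* (fy :- fx) :+ (y :- x) :* fx := y :* fy :- x :* fx) refl x y (f x) (f y))
          (∣∣≤-+ (∣∣≤-scale (≤-trans 0≤x x≤y) (lipschitz F x y 0≤x x≤y y≤B))
                 (∣∣≤-scale 0≤y-x (bounded F x 0≤x (≤-trans x≤y y≤B)))))
    }

  -- The root is the supremum s of the points of the interval from `a` to `B` where f ≤ 0. If f(s) <
  -- 0, then f is still at most 0 at distance -f(s)/K to the right. If f(s) > 0, no point of the set
  -- lies closer than f(s)/K on the left, so a smaller upper bound exists.
  intermediate-value : ∀ {f a B} → LipschitzOn B f → 0# ≤ a → a ≤ B → f a < 0# → 0# < f B →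
    ∃[ s ] a < s × f s ≈ 0#
  intermediate-value {f} {a} {B} F 0≤a a≤B fa<0 0<fB = s , a<s , fs≈0
    where
    S : Carrier → Set
    S t = a ≤ t × t ≤ B × f t ≤ 0#
    sup : ∃[ s ] UpperBound S s × (∀ b → UpperBound S b → s ≤ b)
    sup = supremum S (a , ≤-refl , a≤B , inj₁ fa<0) (B , λ t → proj₁ ∘ proj₂)
    s : Carrier
    s = proj₁ sup
    a≤s : a ≤ s
    a≤s = proj₁ (proj₂ sup) a (≤-refl , a≤B , inj₁ fa<0)
    s≤B : s ≤ B
    s≤B = proj₂ (proj₂ sup) B (λ t → proj₁ ∘ proj₂)
    0≤s : 0# ≤ s
    0≤s = ≤-trans 0≤a a≤s
    increment : ∀ x y → 0# ≤ x → x ≤ y → y ≤ B → f y ≤ f x + K F * (y - x)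
    increment x y 0≤x x≤y y≤B = ≤-by (solve 3 (λ fx fy k → fx :+ k := fy :+ (k :- (fy :- fx))) refl (f x) (f y) _)
      (x≤y⇒0≤y-x (proj₁ (lipschitz F x y 0≤x x≤y y≤B)))

    fs≮0 : ¬ f s < 0#
    fs≮0 fs<0 = <⇒≱ s<t (proj₁ (proj₂ sup) t (≤-trans a≤s (inj₁ s<t) , inj₁ t<B , ft≤0))
      where
      q t : Carrier
      q = proj₁ (quotient (- f s) (0<K F))
      t = s + q
      Kq≈-fs : K F * q ≈ - f s
      Kq≈-fs = proj₂ (quotient (- f s) (0<K F))
      0<-fs : 0# < - f s
      0<-fs = <-respʳ-≈ (+-identityˡ _) (x<y⇒0<y-x fs<0)
      0<q : 0# < q
      0<q = *-cancelˡ-< (inj₁ (0<K F)) (<-respˡ-≈ (sym (zeroʳ _)) (<-respʳ-≈ (sym Kq≈-fs) 0<-fs))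
      s<t : s < t
      s<t = <-by refl 0<q
      -- From 0 < f(B) ≤ f(s) + K (B - s): f needs more than the distance q to become positive at
      -- `B`, so t stays inside the interval.
      q<B-s : q < B - s
      q<B-s = *-cancelˡ-< (inj₁ (0<K F)) (<-respˡ-≈ (sym Kq≈-fs)
        (<-by (solve 2 (λ fs k → k := :- fs :+ (fs :+ k)) refl (f s) _)
          (<-≤-trans 0<fB (increment s B 0≤s s≤B ≤-refl))))
      t<B : t < B
      t<B = <-by (solve 3 (λ s q B → B := (s :+ q) :+ (B :- s :- q)) refl s q B) (x<y⇒0<y-x q<B-s)
      ft≤0 : f t ≤ 0#
      ft≤0 = ≤-trans (increment s t 0≤s (inj₁ s<t) (inj₁ t<B)) (inj₂
        (trans (+-congˡ (trans (*-congˡ (solve 2 (λ s q → s :+ q :- s := q) refl s q)) Kq≈-fs)) (-‿inverseʳ (f s))))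

    0≮fs : ¬ 0# < f s
    0≮fs 0<fs = <⇒≱ t<s (proj₂ (proj₂ sup) t λ x x∈S → below x x∈S)
      where
      q t : Carrier
      q = proj₁ (quotient (f s) (0<K F))
      t = s - q
      Kq≈fs : K F * q ≈ f s
      Kq≈fs = proj₂ (quotient (f s) (0<K F))
      0<q : 0# < q
      0<q = *-cancelˡ-< (inj₁ (0<K F)) (<-respˡ-≈ (sym (zeroʳ _)) (<-respʳ-≈ (sym Kq≈fs) 0<fs))
      t<s : t < s
      t<s = <-by (solve 2 (λ s q → s := (s :- q) :+ q) refl s q) 0<q
      below : UpperBound S t
      below x x∈S@(a≤x , _ , fx≤0) = ≤-by (solve 3 (λ s q x → s :- q := x :+ (s :- x :- q)) refl s q x) (x≤y⇒0≤y-x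
        (*-cancelˡ-≤ (0<K F) (≤-trans (inj₂ Kq≈fs) (≤-trans
          (increment x s (≤-trans 0≤a a≤x) (proj₁ (proj₂ sup) x x∈S) s≤B)
          (≤-trans (+-mono-≤ fx≤0 ≤-refl) (inj₂ (+-identityˡ _)))))))

    fs≈0 : f s ≈ 0#
    fs≈0 = ≤-antisym (≮⇒≥ 0≮fs) (≮⇒≥ fs≮0)
    a<s : a < s
    a<s with a≤s
    ... | inj₁ a<s = a<s
    ... | inj₂ a≈s = contradiction fs≤fa (<⇒≱ (<-respʳ-≈ (sym fs≈0) fa<0))
      where
      s-a≈0 : s - a ≈ 0#
      s-a≈0 = trans (+-congʳ (sym a≈s)) (-‿inverseʳ a)
      fs≤fa : f s ≤ f a
      fs≤fa = ≤-trans (increment a s 0≤a a≤s s≤B)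
        (inj₂ (trans (+-congˡ (trans (*-congˡ s-a≈0) (zeroʳ _))) (+-identityʳ _)))

-- Eigenvalues of nonnegative matrices.

module NonnegativeMatrix (R : CompleteOrderedField) where
  open OrderedField R
  open Spectral R using (ℂ; re; im; _≈ᶜ_; 0ᶜ; _+ᶜ_; _*ᶜ_; ofReal; sumᶜ; IsModulus; Matrix; IsEigenvalue)
  open MonoidSum +-monoid using () renaming (sum to ∑)

  norm² : ℂ → Carrier
  norm² z = re z * re z + im z * im z

  0≤norm² : ∀ z → 0# ≤ norm² z
  0≤norm² z = 0≤+ (0≤x*x (re z)) (0≤x*x (im z))

  norm²-cong : ∀ {z w} → z ≈ᶜ w → norm² z ≈ norm² w
  norm²-cong (re≈ , im≈) = +-cong (*-cong re≈ re≈) (*-cong im≈ im≈)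

  norm²-* : ∀ z w → norm² (z *ᶜ w) ≈ norm² z * norm² w
  norm²-* z w = solve 4 (λ a b c d →
      (a :* c :- b :* d) :* (a :* c :- b :* d) :+ (a :* d :+ b :* c) :* (a :* d :+ b :* c)
   := (a :* a :+ b :* b) :* (c :* c :+ d :* d)) refl (re z) (im z) (re w) (im w)

  norm²≤0⇒≈0 : ∀ {z} → norm² z ≤ 0# → z ≈ᶜ 0ᶜ
  norm²≤0⇒≈0 {z} n≤0 =
    x*x≤0⇒x≈0 (≤-trans (≤-by refl (0≤x*x (im z))) n≤0) ,
    x*x≤0⇒x≈0 (≤-trans (≤-by (+-comm _ _) (0≤x*x (re z))) n≤0)
    where
    x*x≤0⇒x≈0 : ∀ {x} → x * x ≤ 0# → x ≈ 0#
    x*x≤0⇒x≈0 {x} x²≤0 = ≤-antisym (≤0 x²≤0)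
      (≤-by (solve 1 (λ x → x := con (+ 0) :+ (con (+ 0) :- :- x)) refl x) (x≤y⇒0≤y-x
        (≤0 (≤-trans (inj₂ (solve 1 (λ x → :- x :* :- x := x :* x) refl x)) x²≤0))))
      where
      ≤0 : ∀ {x} → x * x ≤ 0# → x ≤ 0#
      ≤0 x²≤0 = square-cancel-≤ ≤-refl (≤-trans x²≤0 (inj₂ (sym (zeroˡ 0#))))

  -- The triangle inequality for moduli at most √T a and √T b, in squared form. The cross term is
  -- bounded by Cauchy-Schwarz, which comes from Lagrange's identity.
  norm²-+-≤ : ∀ {T a b} z w → 0# ≤ T → 0# ≤ a → 0# ≤ b → norm² z ≤ T * (a * a) → norm² w ≤ T * (b * b) →
    norm² (z +ᶜ w) ≤ T * ((a + b) * (a + b))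
  norm²-+-≤ {T} {a} {b} z w 0≤T 0≤a 0≤b z≤ w≤ = ≤-trans
    (inj₂ (solve 4 (λ x y u v → (x :+ u) :* (x :+ u) :+ (y :+ v) :* (y :+ v)
                                := (x :* x :+ y :* y) :+ (u :* u :+ v :* v) :+
                                   ((x :* u :+ y :* v) :+ (x :* u :+ y :* v)))
             refl (re z) (im z) (re w) (im w)))
    (≤-trans (+-mono-≤ (+-mono-≤ z≤ w≤) (+-mono-≤ cross≤ cross≤))
      (inj₂ (solve 3 (λ t a b → t :* (a :* a) :+ t :* (b :* b) :+ (t :* (a :* b) :+ t :* (a :* b))
                               := t :* ((a :+ b) :* (a :+ b))) refl T a b)))
    where
    cross : Carrier
    cross = re z * re w + im z * im w
    cross²≤ : cross * cross ≤ norm² z * norm² w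
    cross²≤ = ≤-by
      (solve 4 (λ x y u v → (x :* x :+ y :* y) :* (u :* u :+ v :* v)
                            := (x :* u :+ y :* v) :* (x :* u :+ y :* v) :+ (x :* v :- y :* u) :* (x :* v :- y :* u))
        refl (re z) (im z) (re w) (im w))
      (0≤x*x (re z * im w - im z * re w))
    cross≤ : cross ≤ T * (a * b)
    cross≤ = square-cancel-≤ (0≤* 0≤T (0≤* 0≤a 0≤b)) (≤-trans cross²≤
      (≤-trans (*-mono-≤ (0≤* 0≤T (0≤* 0≤a 0≤a)) (0≤norm² w) z≤ w≤)
        (inj₂ (solve 3 (λ t a b → t :* (a :* a) :* (t :* (b :* b)) := t :* (a :* b) :* (t :* (a :* b))) refl T a b))))

  0≤∑ : ∀ {n} {b : Fin n → Carrier} → (∀ j → 0# ≤ b j) → 0# ≤ ∑ b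
  0≤∑ {zero}  0≤b = ≤-refl
  0≤∑ {suc n} 0≤b = 0≤+ (0≤b Fin.zero) (0≤∑ (0≤b ∘ Fin.suc))

  norm²-sum-≤ : ∀ {n T} (z : Fin n → ℂ) (b : Fin n → Carrier) → 0# ≤ T → (∀ j → 0# ≤ b j) →
    (∀ j → norm² (z j) ≤ T * (b j * b j)) → norm² (sumᶜ z) ≤ T * (∑ b * ∑ b)
  norm²-sum-≤ {zero} {T} z b 0≤T 0≤b z≤ = inj₂
    (solve 1 (λ t → con (+ 0) :* con (+ 0) :+ con (+ 0) :* con (+ 0) := t :* (con (+ 0) :* con (+ 0))) refl T)
  norm²-sum-≤ {suc n} z b 0≤T 0≤b z≤ =
    norm²-+-≤ (z Fin.zero) (sumᶜ (z ∘ Fin.suc)) 0≤T (0≤b Fin.zero) (0≤∑ (0≤b ∘ Fin.suc))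
      (z≤ Fin.zero) (norm²-sum-≤ (z ∘ Fin.suc) (b ∘ Fin.suc) 0≤T (0≤b ∘ Fin.suc) (z≤ ∘ Fin.suc))

  argmax : ∀ {n} (t : Fin (suc n) → Carrier) → ∃[ i ] ∀ j → t j ≤ t i
  argmax {zero}  t = Fin.zero , λ { Fin.zero → ≤-refl }
  argmax {suc n} t with argmax (t ∘ Fin.suc)
  ... | i , t≤tᵢ with ≤-total (t Fin.zero) (t (Fin.suc i))
  ...   | inj₁ t₀≤tᵢ = Fin.suc i , λ { Fin.zero → t₀≤tᵢ ; (Fin.suc j) → t≤tᵢ j }
  ...   | inj₂ tᵢ≤t₀ = Fin.zero , λ { Fin.zero → ≤-refl ; (Fin.suc j) → ≤-trans (t≤tᵢ j) tᵢ≤t₀ }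

  -- Collatz–Wielandt: at the index i maximising |vᵢ|/yᵢ the eigenvalue equation for v is dominated by the one for y.
  -- Everything is squared, as there are no square roots.
  eigenvalue-modulus-≤ : ∀ {m} (A : Matrix Carrier (suc m)) (y : Fin (suc m) → Carrier) {s} →
    (∀ i j → 0# ≤ A i j) → (∀ i → 0# < y i) → 0# ≤ s → (∀ i → ∑ (λ j → A i j * y j) ≤ s * y i) →
    ∀ μ r → IsEigenvalue (λ i j → ofReal (A i j)) μ → IsModulus μ r → r ≤ s
  eigenvalue-modulus-≤ {m} A y {s} 0≤A 0<y 0≤s Ay≤sy μ r (v , v≉0 , Av≈μv) (0≤r , r²≈) =
    square-cancel-≤ 0≤s (*-cancelˡ-≤ 0<vᵢ (begin
      norm² (v i) * (r * r)            ≈⟨ *-congˡ r²≈ ⟩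
      norm² (v i) * norm² μ            ≈⟨ *-comm _ _ ⟩
      norm² μ * norm² (v i)            ≈⟨ norm²-* μ (v i) ⟨
      norm² (μ *ᶜ v i)                 ≈⟨ norm²-cong (Av≈μv i) ⟨
      norm² (sumᶜ (λ j → ofReal (A i j) *ᶜ v j))
        ≤⟨ norm²-sum-≤ _ (λ j → A i j * y j) 0≤T 0≤Ay term≤ ⟩
      T * (∑ (λ j → A i j * y j) * ∑ (λ j → A i j * y j))
        ≤⟨ *-monoˡ-≤ 0≤T (*-mono-≤ (0≤* 0≤s (inj₁ (0<y i))) (0≤∑ 0≤Ay) (Ay≤sy i) (Ay≤sy i)) ⟩
      T * (s * y i * (s * y i))
        ≈⟨ solve 3 (λ t s y → t :* (s :* y :* (s :* y)) := t :* (y :* y) :* (s :* s)) refl T s (y i) ⟩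
      T * (y i * y i) * (s * s)        ≈⟨ *-congʳ (norm²≈ i) ⟨
      norm² (v i) * (s * s)            ∎))
    where
    open ≤-Reasoning
    ratio : ∀ i → ∃[ t ] y i * y i * t ≈ norm² (v i)
    ratio i = quotient (norm² (v i)) (*-pos (0<y i) (0<y i))
    i : Fin (suc m)
    i = proj₁ (argmax (proj₁ ∘ ratio))
    T : Carrier
    T = proj₁ (ratio i)
    norm²≈ : ∀ j → norm² (v j) ≈ proj₁ (ratio j) * (y j * y j)
    norm²≈ j = trans (sym (proj₂ (ratio j))) (*-comm _ _)
    norm²≤ : ∀ j → norm² (v j) ≤ T * (y j * y j)
    norm²≤ j = ≤-trans (inj₂ (sym (proj₂ (ratio j)))) (≤-trans
      (*-monoˡ-≤ (inj₁ (*-pos (0<y j) (0<y j))) (proj₂ (argmax (proj₁ ∘ ratio)) j)) (inj₂ (*-comm _ _)))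
    0≤T : 0# ≤ T
    0≤T = *-cancelˡ-≤ (*-pos (0<y i) (0<y i))
      (≤-trans (inj₂ (zeroʳ _)) (≤-trans (0≤norm² (v i)) (inj₂ (sym (proj₂ (ratio i))))))
    0<vᵢ : 0# < norm² (v i)
    -- If vᵢ vanished, the maximal ratio T would be at most 0, and every entry of v would vanish
    -- with it.
    0<vᵢ = ≰⇒> λ vᵢ≤0 → v≉0 λ j → norm²≤0⇒≈0 (≤-trans (norm²≤ j) (≤-trans
      (*-mono-≤ ≤-refl (0≤x*x (y j)) (T≤0 vᵢ≤0) ≤-refl) (inj₂ (zeroˡ _))))
      where
      T≤0 : norm² (v i) ≤ 0# → T ≤ 0#
      T≤0 vᵢ≤0 = *-cancelˡ-≤ (*-pos (0<y i) (0<y i))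
        (≤-trans (inj₂ (proj₂ (ratio i))) (≤-trans vᵢ≤0 (inj₂ (sym (zeroʳ _)))))
    0≤Ay : ∀ j → 0# ≤ A i j * y j
    0≤Ay j = 0≤* (0≤A i j) (inj₁ (0<y j))
    term≤ : ∀ j → norm² (ofReal (A i j) *ᶜ v j) ≤ T * (A i j * y j * (A i j * y j))
    term≤ j = begin
      norm² (ofReal (A i j) *ᶜ v j)             ≈⟨ norm²-* (ofReal (A i j)) (v j) ⟩
      norm² (ofReal (A i j)) * norm² (v j)
        ≈⟨ *-congʳ (solve 1 (λ a → a :* a :+ con (+ 0) :* con (+ 0) := a :* a) refl (A i j)) ⟩
      A i j * A i j * norm² (v j)               ≤⟨ *-monoˡ-≤ (0≤x*x (A i j)) (norm²≤ j) ⟩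
      A i j * A i j * (T * (y j * y j))
        ≈⟨ solve 3 (λ a t y → a :* a :* (t :* (y :* y)) := t :* (a :* y :* (a :* y))) refl (A i j) T (y j) ⟩
      T * (A i j * y j * (A i j * y j))         ∎

  sumᶜ-ofReal : ∀ {n} (a b : Fin n → Carrier) →
    sumᶜ (λ j → ofReal (a j) *ᶜ ofReal (b j)) ≈ᶜ ofReal (∑ (λ j → a j * b j))
  sumᶜ-ofReal {zero}  a b = refl , refl
  sumᶜ-ofReal {suc n} a b with sumᶜ-ofReal (a ∘ Fin.suc) (b ∘ Fin.suc)
  ... | re≈ , im≈ =
    +-cong (solve 2 (λ a b → a :* b :- con (+ 0) :* con (+ 0) := a :* b) refl (a Fin.zero) (b Fin.zero)) re≈ ,
    trans (+-congˡ im≈) (solve 2 (λ a b → a :* con (+ 0) :+ con (+ 0) :* b :+ con (+ 0) := con (+ 0)) refl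
                          (a Fin.zero) (b Fin.zero))

  realEigenvalue : ∀ {m} (A : Matrix Carrier m) (v : Fin m → Carrier) {s} → (¬ ∀ i → v i ≈ 0#) →
    (∀ i → ∑ (λ j → A i j * v j) ≈ s * v i) → IsEigenvalue (λ i j → ofReal (A i j)) (ofReal s)
  realEigenvalue A v {s} v≉0 Av≈sv = (λ i → ofReal (v i)) , (λ v≈0 → v≉0 λ i → proj₁ (v≈0 i)) , λ i →
    trans (proj₁ (sumᶜ-ofReal (A i) v)) (trans (Av≈sv i)
      (solve 2 (λ s v → s :* v := s :* v :- con (+ 0) :* con (+ 0)) refl s (v i))) ,
    trans (proj₂ (sumᶜ-ofReal (A i) v)) (solve 2 (λ s v → con (+ 0) := s :* con (+ 0) :+ con (+ 0) :* v) refl s (v i))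

-- The polynomials `p` and their behaviour for large arguments.

module HorizontalSpectrum (R : CompleteOrderedField) (h : ℕ → CompleteOrderedField.Carrier R)
  (0<h : ∀ n → 1 ℕ.≤ n → CompleteOrderedField._<_ R (CompleteOrderedField.0# R) (h n)) where

  open OrderedField R
  open Spectral R using (fromℤ; ofReal; IsModulus; Matrix; IsEigenvalue; IsSpectralRadius; entry; M)
  open NonnegativeMatrix R using (eigenvalue-modulus-≤; realEigenvalue)
  open Dot commutativeRing using (dot; convolution≈dot)
  open MonoidSum +-monoid using ()
    renaming (sum to ∑; sum-init-last to ∑-init-last; sum-cong-≋ to ∑-cong; sum-cong-≗ to ∑-cong-≗)

  cᴿ : ℕ → Carrier
  cᴿ n = fromℤ (c n)

  c₀≈1 : cᴿ 0 ≈ 1#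
  c₀≈1 = +-identityʳ 1#

  0<fromℤ : ∀ {i} → ℤ.0ℤ ℤ.< i → 0# < fromℤ i
  0<fromℤ {+ suc zero}    _ = 0<+0≤ 0<1 ≤-refl
  0<fromℤ {+ suc (suc k)} _ = 0<+ 0<1 (0<fromℤ {+ suc k} (ℤ.+<+ (s≤s z≤n)))
  0<fromℤ {+ zero}        (ℤ.+<+ ())

  0<cᴿ : ∀ n → 0# < cᴿ n
  0<cᴿ n = 0<fromℤ (0<c n)

  h⁻¹ : ℕ → Carrier
  h⁻¹ k = proj₁ (reciprocal (0<h (suc k) (s≤s z≤n)))

  h*h⁻¹≈1 : ∀ k → h (suc k) * h⁻¹ k ≈ 1#
  h*h⁻¹≈1 k = proj₁ (proj₂ (reciprocal (0<h (suc k) (s≤s z≤n))))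

  0<h⁻¹ : ∀ k → 0# < h⁻¹ k
  0<h⁻¹ k = proj₂ (proj₂ (reciprocal (0<h (suc k) (s≤s z≤n))))

  -- As M h n is lower Hessenberg with positive superdiagonal, the eigenvalue equation at x determines the
  -- eigenvector from its first entry: the entry with (0-based) index j is h⁻¹ j * p j x.  The last row then
  -- says that p (n - 1) x vanishes, so p (n - 1) is the characteristic polynomial up to a factor.
  mutual
    p : ℕ → Carrier → Carrier
    p zero    x = 1#
    p (suc k) x = x * (h⁻¹ k * p k x) - dot (cᴿ ∘ suc) (ps (suc k) x)

    -- This is `history (λ j → p j x) k`, unfolded together with `p` so that the mutual recursion
    -- visibly terminates.
    ps : ℕ → Carrier → List Carrier
    ps zero    x = []
    ps (suc k) x = p k x ∷ ps k x

  ps≡history : ∀ k x → ps k x ≡ history (λ j → p j x) k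
  ps≡history zero    x = ≡.refl
  ps≡history (suc k) x = cong (p k x ∷_) (ps≡history k x)

  mutual
    p-cong : ∀ k {x y} → x ≈ y → p k x ≈ p k y
    p-cong zero    x≈y = refl
    p-cong (suc k) x≈y = +-cong (*-cong x≈y (*-congˡ (p-cong k x≈y))) (-‿cong (dot-ps-cong (cᴿ ∘ suc) (suc k) x≈y))

    dot-ps-cong : ∀ a k {x y} → x ≈ y → dot a (ps k x) ≈ dot a (ps k y)
    dot-ps-cong a zero    x≈y = refl
    dot-ps-cong a (suc k) x≈y = +-cong (*-congˡ (p-cong k x≈y)) (dot-ps-cong (a ∘ suc) k x≈y)

  mutual
    p-lipschitz : ∀ {B} → 0# < B → ∀ k → LipschitzOn B (p k)
    p-lipschitz 0<B zero    = lipschitz-constant _ 1#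
      (≤-refl , ≤-by (solve 1 (λ i → i := :- i :+ (i :+ i)) refl 1#) (inj₁ (0<+ 0<1 0<1)))
    p-lipschitz 0<B (suc k) = lipschitz-sub (lipschitz-id* 0<B (lipschitz-scale (0<h⁻¹ k) (p-lipschitz 0<B k)))
                                            (dot-ps-lipschitz 0<B (cᴿ ∘ suc) (0<cᴿ ∘ suc) (suc k))

    dot-ps-lipschitz : ∀ {B} → 0# < B → ∀ a → (∀ j → 0# < a j) → ∀ k → LipschitzOn B (λ x → dot a (ps k x))
    dot-ps-lipschitz 0<B a 0<a zero    = lipschitz-constant _ 0#
      (inj₁ 0<1 , ≤-by (solve 1 (λ i → i := :- con (+ 0) :+ i) refl 1#) (inj₁ 0<1))
    dot-ps-lipschitz 0<B a 0<a (suc k) = lipschitz-+ (lipschitz-scale (0<a 0) (p-lipschitz 0<B k))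
                                                     (dot-ps-lipschitz 0<B (a ∘ suc) (0<a ∘ suc) k)

  0≤dot-ps : ∀ a → (∀ j → 0# < a j) → ∀ k x → (∀ j → j ℕ.< k → 0# < p j x) → 0# ≤ dot a (ps k x)
  0≤dot-ps a 0<a zero    x 0<p = ≤-refl
  0≤dot-ps a 0<a (suc k) x 0<p = 0≤+ (inj₁ (*-pos (0<a 0) (0<p k ℕ.≤-refl)))
    (0≤dot-ps (a ∘ suc) (0<a ∘ suc) k x λ j j<k → 0<p j (ℕ.m≤n⇒m≤1+n j<k))

  0<dot-ps : ∀ a → (∀ j → 0# < a j) → ∀ k x → (∀ j → j ℕ.≤ k → 0# < p j x) → 0# < dot a (ps (suc k) x)
  0<dot-ps a 0<a k x 0<p = 0<+0≤ (*-pos (0<a 0) (0<p k ℕ.≤-refl))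
    (0≤dot-ps (a ∘ suc) (0<a ∘ suc) k x λ j j<k → 0<p j (ℕ.<⇒≤ j<k))

  partialSum : (ℕ → Carrier) → ℕ → Carrier
  partialSum a zero    = 0#
  partialSum a (suc k) = a 0 + partialSum (a ∘ suc) k

  dot-ps-≤ : ∀ a → (∀ j → 0# < a j) → ∀ k {x b} → All (_≤ b) (ps k x) → dot a (ps k x) ≤ partialSum a k * b
  dot-ps-≤ a 0<a zero    {b = b} []         = inj₂ (sym (zeroˡ b))
  dot-ps-≤ a 0<a (suc k) {b = b} (p≤ ∷ ps≤) = ≤-trans
    (+-mono-≤ (*-monoˡ-≤ (inj₁ (0<a 0)) p≤) (dot-ps-≤ (a ∘ suc) (0<a ∘ suc) k ps≤)) (inj₂ (sym (distribʳ b _ _)))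

  -- Provides points where `p k` is positive. If all earlier polynomials are at most pₖ at x, the
  -- subtracted dot product is at most S pₖ, where S = c₁ + ... + cₖ₊₁. For x ≥ h(k+1)(1 + S) this
  -- gives pₖ₊₁ ≥ (1 + S) pₖ - S pₖ = pₖ, and the domination persists.
  p-eventually-increasing : ∀ k → ∃[ B ] ∀ x → B ≤ x → 0# < p k x × All (_≤ p k x) (ps k x)
  p-eventually-increasing zero    = 0# , λ x _ → 0<1 , []
  p-eventually-increasing (suc k) = B′ , λ x B′≤x →
    let 0<pₖ , ps≤pₖ = proj₂ (p-eventually-increasing k) x (≤-trans (proj₁ (proj₂ bound)) B′≤x)
        pₖ≤pₖ₊₁      = pₖ≤pₖ₊₁ x (≤-trans (proj₂ (proj₂ bound)) B′≤x) 0<pₖ ps≤pₖ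
    in <-≤-trans 0<pₖ pₖ≤pₖ₊₁ , pₖ≤pₖ₊₁ ∷ All.map (λ ≤pₖ → ≤-trans ≤pₖ pₖ≤pₖ₊₁) ps≤pₖ
    where
    S : Carrier
    S = partialSum (cᴿ ∘ suc) (suc k)
    bound : ∃[ z ] proj₁ (p-eventually-increasing k) ≤ z × h (suc k) * (1# + S) ≤ z
    bound = upper-bound _ _
    B′ : Carrier
    B′ = proj₁ bound
    pₖ≤pₖ₊₁ : ∀ x → h (suc k) * (1# + S) ≤ x → 0# < p k x → All (_≤ p k x) (ps k x) → p k x ≤ p (suc k) x
    pₖ≤pₖ₊₁ x h[1+S]≤x 0<pₖ ps≤pₖ = ≤-by
      (solve 5 (λ x h⁻¹ q s e → x :* (h⁻¹ :* q) :- e := q :+ ((h⁻¹ :* x :- (con (+ 1) :+ s)) :* q :+ (s :* q :- e)))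
        refl x (h⁻¹ k) (p k x) S _)
      (0≤+ (0≤* (x≤y⇒0≤y-x 1+S≤h⁻¹x) (inj₁ 0<pₖ))
           (x≤y⇒0≤y-x (dot-ps-≤ (cᴿ ∘ suc) (0<cᴿ ∘ suc) (suc k) (≤-refl ∷ ps≤pₖ))))
      where
      1+S≤h⁻¹x : 1# + S ≤ h⁻¹ k * x
      1+S≤h⁻¹x = begin
        1# + S                        ≈⟨ *-identityˡ _ ⟨
        1# * (1# + S)                 ≈⟨ *-congʳ (trans (*-comm _ _) (h*h⁻¹≈1 k)) ⟨
        h⁻¹ k * h (suc k) * (1# + S)    ≈⟨ *-assoc _ _ _ ⟩
        h⁻¹ k * (h (suc k) * (1# + S))  ≤⟨ *-monoˡ-≤ (inj₁ (0<h⁻¹ k)) h[1+S]≤x ⟩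
        h⁻¹ k * x                       ∎
        where open ≤-Reasoning

  root-beyond : ∀ k {x} → 0# ≤ x → p k x < 0# → ∃[ s ] x < s × p k s ≈ 0#
  root-beyond k {x} 0≤x pₖ<0 =
    intermediate-value (p-lipschitz 0<B k) 0≤x (inj₁ x<B) pₖ<0
      (proj₁ (proj₂ (p-eventually-increasing k) B (proj₁ (proj₂ bound))))
    where
    bound : ∃[ z ] proj₁ (p-eventually-increasing k) ≤ z × x + 1# ≤ z
    bound = upper-bound _ _
    B : Carrier
    B = proj₁ bound
    x<B : x < B
    x<B = <-≤-trans (<-by refl 0<1) (proj₂ (proj₂ bound))
    0<B : 0# < B
    0<B = ≤-<-trans 0≤x x<B

  -- Eigenvectors of `M h n` and its spectral radius.

  entry-≤ : ∀ {i j} → j ℕ.≤ i ℕ.+ 1 → entry h i j ≡ cᴿ (i ℕ.+ 1 ∸ j) * h j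
  entry-≤ {i} {j} j≤ with j ℕ.≤? i ℕ.+ 1
  ... | yes _  = ≡.refl
  ... | no  j≰ = contradiction j≤ j≰

  entry-> : ∀ {i j} → i ℕ.+ 1 ℕ.< j → entry h i j ≡ 0#
  entry-> {i} {j} j> with j ℕ.≤? i ℕ.+ 1
  ... | yes j≤ = contradiction j≤ (ℕ.<⇒≱ j>)
  ... | no  _  = ≡.refl

  0≤entry : ∀ i j → 1 ℕ.≤ j → 0# ≤ entry h i j
  0≤entry i j 1≤j with j ℕ.≤? i ℕ.+ 1
  ... | yes _ = inj₁ (*-pos (0<cᴿ (i ℕ.+ 1 ∸ j)) (0<h j 1≤j))
  ... | no  _ = ≤-refl

  ∑-extend : ∀ {m n} F → m ℕ.≤ n → (∀ j → m ℕ.≤ j → F j ≈ 0#) → ∑ {n} (F ∘ toℕ) ≈ ∑ {m} (F ∘ toℕ)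
  ∑-extend {m} {n} F m≤n F≈0 with ℕ.m≤n⇒m<n∨m≡n m≤n
  ... | inj₂ ≡.refl = refl
  ∑-extend {m} {suc n} F m≤n F≈0 | inj₁ (s≤s m≤n′) = begin
    ∑ {suc n} (F ∘ toℕ)                                  ≈⟨ ∑-init-last (F ∘ toℕ) ⟩
    ∑ {n} (F ∘ toℕ ∘ Fin.inject₁) + F (toℕ (Fin.fromℕ n))
      ≡⟨ cong₂ _+_ (∑-cong-≗ {n} {F ∘ toℕ ∘ Fin.inject₁} {F ∘ toℕ} λ j → cong F (Fin.toℕ-inject₁ j))
                   (cong F (Fin.toℕ-fromℕ n)) ⟩
    ∑ {n} (F ∘ toℕ) + F n                                ≈⟨ +-cong (∑-extend F m≤n′ F≈0) (F≈0 n m≤n′) ⟩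
    ∑ {m} (F ∘ toℕ) + 0#                                 ≈⟨ +-identityʳ _ ⟩
    ∑ {m} (F ∘ toℕ)                                      ∎
    where open import Relation.Binary.Reasoning.Setoid setoid

  eigenvector : ∀ m → Carrier → Fin m → Carrier
  eigenvector m x j = h⁻¹ (toℕ j) * p (toℕ j) x

  -- Counting from 0, row k vanishes beyond column k + 1, so the sum can be taken over k + 2 columns
  -- whatever the matrix size. The factors of h cancel, and what remains is the convolution that
  -- defines `p (suc k)`.
  eigenvector-equation : ∀ m x → p m x ≈ 0# → ∀ i →
    ∑ (λ j → M h (suc m) i j * eigenvector m x j) ≈ x * eigenvector m x i
  eigenvector-equation m x pₘ≈0 i = begin
    ∑ {m} (F ∘ toℕ)                                    ≈⟨ truncate (ℕ.≤-total m (2 ℕ.+ k)) ⟩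
    ∑ {2 ℕ.+ k} (F ∘ toℕ)                              ≈⟨ ∑-cong (λ j → row (toℕ j) (ℕ.≤-pred (Fin.toℕ<n j))) ⟩
    ∑ {2 ℕ.+ k} (λ j → cᴿ (suc k ∸ toℕ j) * p (toℕ j) x) ≈⟨ convolution≈dot cᴿ (λ j → p j x) (2 ℕ.+ k) ⟩
    cᴿ 0 * p (suc k) x + dot (cᴿ ∘ suc) (history (λ j → p j x) (suc k))
      ≈⟨ +-cong (trans (*-congʳ c₀≈1) (*-identityˡ _))
               (reflexive (cong (dot (cᴿ ∘ suc)) (≡.sym (ps≡history (suc k) x)))) ⟩
    p (suc k) x + dot (cᴿ ∘ suc) (ps (suc k) x)
      ≈⟨ solve 2 (λ u v → u :- v :+ v := u) refl (x * (h⁻¹ k * p k x)) (dot (cᴿ ∘ suc) (ps (suc k) x)) ⟩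
    x * (h⁻¹ k * p k x)                                  ∎
    where
    open import Relation.Binary.Reasoning.Setoid setoid
    k : ℕ
    k = toℕ i
    F : ℕ → Carrier
    F j = entry h (suc k) (suc j) * (h⁻¹ j * p j x)
    row : ∀ j → j ℕ.≤ suc k → F j ≈ cᴿ (suc k ∸ j) * p j x
    row j j≤1+k rewrite entry-≤ {suc k} {suc j} (subst (suc j ℕ.≤_) (ℕ.+-comm 1 (suc k)) (s≤s j≤1+k)) | ℕ.+-comm k 1 =
      trans (solve 4 (λ cᴿ h h⁻¹ p → cᴿ :* h :* (h⁻¹ :* p) := cᴿ :* (h :* h⁻¹) :* p) refl _ (h (suc j)) (h⁻¹ j) (p j x))
            (*-congʳ (trans (*-congˡ (h*h⁻¹≈1 j)) (*-identityʳ _)))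
    beyond : ∀ j → 2 ℕ.+ k ℕ.≤ j → F j ≈ 0#
    beyond j 2+k≤j = trans (*-congʳ (reflexive
      (entry-> {suc k} {suc j} (subst (ℕ._< suc j) (ℕ.+-comm 1 (suc k)) (s≤s 2+k≤j))))) (zeroˡ _)
    -- In the last row, k + 2 exceeds the number m of columns by one. The extra term, at j = m,
    -- vanishes because x is a root of `p m`.
    last : ∀ j → m ℕ.≤ j → F j ≈ 0#
    last j m≤j with ℕ.m≤n⇒m<n∨m≡n m≤j
    ... | inj₁ m<j    = beyond j (ℕ.≤-trans (s≤s (Fin.toℕ<n i)) m<j)
    ... | inj₂ ≡.refl = trans (*-congˡ (trans (*-congˡ pₘ≈0) (zeroʳ _))) (zeroʳ _)
    truncate : m ℕ.≤ 2 ℕ.+ k ⊎ 2 ℕ.+ k ℕ.≤ m → ∑ {m} (F ∘ toℕ) ≈ ∑ {2 ℕ.+ k} (F ∘ toℕ)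
    truncate (inj₁ m≤2+k) = sym (∑-extend F m≤2+k last)
    truncate (inj₂ 2+k≤m) = ∑-extend F 2+k≤m beyond

  -- The positive eigenvector bounds all moduli by s, and s is itself an eigenvalue. As ρ is given,
  -- this also shows that any two such roots coincide, which is used below as uniqueness.
  spectralRadius≈root : ∀ m {s ρ} → 0# ≤ s → (∀ j → j ℕ.≤ m → 0# < p j s) → p (suc m) s ≈ 0# →
    IsSpectralRadius (M h (2 ℕ.+ m)) ρ → ρ ≈ s
  spectralRadius≈root m {s} {ρ} 0≤s 0<p p≈0 ((μ , μ-eigenvalue , μ-modulus) , ρ-largest) = ≤-antisym
    (eigenvalue-modulus-≤ A v (λ i j → 0≤entry (suc (toℕ i)) (suc (toℕ j)) (s≤s z≤n)) 0<v 0≤s (λ i → inj₂ (Av≈sv i))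
      μ ρ μ-eigenvalue μ-modulus)
    (ρ-largest (ofReal s) s (realEigenvalue A v (λ v≈0 → <-irrefl (sym (v≈0 Fin.zero)) (0<v Fin.zero)) Av≈sv)
      (0≤s , solve 1 (λ s → s :* s := s :* s :+ con (+ 0) :* con (+ 0)) refl s))
    where
    A : Matrix Carrier (suc m)
    A = M h (2 ℕ.+ m)
    v : Fin (suc m) → Carrier
    v = eigenvector (suc m) s
    0<v : ∀ i → 0# < v i
    0<v i = *-pos (0<h⁻¹ (toℕ i)) (0<p (toℕ i) (ℕ.≤-pred (Fin.toℕ<n i)))
    Av≈sv : ∀ i → ∑ (λ j → A i j * v j) ≈ s * v i
    Av≈sv = eigenvector-equation (suc m) s p≈0

  -- Induction along the largest roots.

  -- For m ≥ 1, r is the largest root of p m.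
  record PositiveBeyond (m : ℕ) (r : Carrier) : Set where
    field
      0≤r      : 0# ≤ r
      positive : ∀ x → r < x → ∀ j → j ℕ.≤ m → 0# < p j x
      negative : p (suc m) r < 0#

  -- Only -e is left of the recursion once the product x pₖ(x) vanishes. Phrasing the hypothesis for
  -- the product covers both the start, where x = 0, and the later steps, where pₖ(x) = 0.
  p-suc<0 : ∀ k {x} → x * p k x ≈ 0# → 0# < dot (cᴿ ∘ suc) (ps (suc k) x) → p (suc k) x < 0#
  p-suc<0 k {x} xpₖ≈0 0<e = <-by 0≈pₖ₊₁+e 0<e
    where
    e : Carrier
    e = dot (cᴿ ∘ suc) (ps (suc k) x)
    0≈pₖ₊₁+e : 0# ≈ x * (h⁻¹ k * p k x) - e + e
    0≈pₖ₊₁+e = trans (sym (trans (*-congˡ xpₖ≈0) (zeroʳ (h⁻¹ k))))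
      (solve 4 (λ x h⁻¹ q e → h⁻¹ :* (x :* q) := x :* (h⁻¹ :* q) :- e :+ e) refl x (h⁻¹ k) (p k x) e)

  -- The constant p₀ has no root, so 0 takes the place of one; the first inductive step then yields
  -- 0 < ρ₂.
  positiveBeyond-zero : PositiveBeyond 0 0#
  positiveBeyond-zero = record
    { 0≤r      = ≤-refl
    ; positive = λ { x 0<x .0 z≤n → 0<1 }
    ; negative = p-suc<0 0 (zeroˡ 1#) (0<dot-ps (cᴿ ∘ suc) (0<cᴿ ∘ suc) 0 0# λ { .0 z≤n → 0<1 })
    }

  -- Every root of `p (suc m)` beyond r equals ρ. To the right of ρ the polynomial therefore cannot
  -- vanish, nor can it be negative, as `root-beyond` would produce a further root.
  positive-beyond-root : ∀ m {r ρ} → PositiveBeyond m r → r < ρ → (∀ {x} → r < x → p (suc m) x ≈ 0# → ρ ≈ x) →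
    ∀ x → ρ < x → ∀ j → j ℕ.≤ suc m → 0# < p j x
  positive-beyond-root m {r} {ρ} r-beyond r<ρ ρ≈root x ρ<x j j≤1+m with ℕ.m≤n⇒m<n∨m≡n j≤1+m
  ... | inj₁ (s≤s j≤m) = PositiveBeyond.positive r-beyond x (<-trans r<ρ ρ<x) j j≤m
  ... | inj₂ ≡.refl with compare (p (suc m) x) 0#
  ...   | tri> _ _ 0<p = 0<p
  ...   | tri≈ _ p≈0 _ = contradiction ρ<x (<-irrefl (ρ≈root (<-trans r<ρ ρ<x) p≈0))
  ...   | tri< p<0 _ _ =
    let s , x<s , p≈0 = root-beyond (suc m) (inj₁ (≤-<-trans (PositiveBeyond.0≤r r-beyond) (<-trans r<ρ ρ<x))) p<0
    in contradiction (<-trans ρ<x x<s) (<-irrefl (ρ≈root (<-trans r<ρ (<-trans ρ<x x<s)) p≈0))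

  -- The negative value at r forces a root of `p (suc m)` beyond r. All earlier polynomials are
  -- positive there, so this root is the spectral radius ρ.
  positiveBeyond-suc : ∀ m {r ρ} → PositiveBeyond m r → IsSpectralRadius (M h (2 ℕ.+ m)) ρ →
    r < ρ × PositiveBeyond (suc m) ρ
  positiveBeyond-suc m {r} {ρ} r-beyond ρ-radius = r<ρ , record
    { 0≤r      = inj₁ (≤-<-trans 0≤r r<ρ)
    ; positive = positive-beyond-root m r-beyond r<ρ ρ≈root
    ; negative = p-suc<0 (suc m) (trans (*-congˡ p[ρ]≈0) (zeroʳ ρ)) 0<e
    }
    where
    open PositiveBeyond r-beyond
    root : ∃[ s ] r < s × p (suc m) s ≈ 0#
    root = root-beyond (suc m) 0≤r negative
    ρ≈root : ∀ {x} → r < x → p (suc m) x ≈ 0# → ρ ≈ x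
    ρ≈root r<x p≈0 = spectralRadius≈root m (≤-trans 0≤r (inj₁ r<x)) (positive _ r<x) p≈0 ρ-radius
    ρ≈s : ρ ≈ proj₁ root
    ρ≈s = ρ≈root (proj₁ (proj₂ root)) (proj₂ (proj₂ root))
    r<ρ : r < ρ
    r<ρ = <-respʳ-≈ (sym ρ≈s) (proj₁ (proj₂ root))
    p[ρ]≈0 : p (suc m) ρ ≈ 0#
    p[ρ]≈0 = trans (p-cong (suc m) ρ≈s) (proj₂ (proj₂ root))
    e : Carrier
    e = dot (cᴿ ∘ suc) (ps (2 ℕ.+ m) ρ)
    -- The leading term c₁ pₘ₊₁(ρ) of e is zero; the others, c₂ pₘ(ρ) + ..., involve only
    -- polynomials already positive at ρ.
    0<e : 0# < e
    0<e = <-respʳ-≈ (sym (trans (+-congʳ (trans (*-congˡ p[ρ]≈0) (zeroʳ (cᴿ 1)))) (+-identityˡ _)))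
      (0<dot-ps (cᴿ ∘ suc ∘ suc) (λ j → 0<cᴿ (2 ℕ.+ j)) m ρ (positive ρ r<ρ))

theorem2p5 : (R : CompleteOrderedField) → let open Spectral R in
    (h : ℕ → ℝ) → (∀ n → 1 ℕ.≤ n → 0# < h n) → h 1 ≈ 1# →
    (ρ : ℕ → ℝ) → (∀ n → 2 ℕ.≤ n → IsSpectralRadius (M h n) (ρ n)) →
    0# < ρ 2 × (∀ n → 2 ℕ.≤ n → ρ n < ρ (suc n))
theorem2p5 R h 0<h _ ρ ρ-radius = proj₁ first , increasing
  where
  open CompleteOrderedField R
  open HorizontalSpectrum R h 0<h
  first : 0# < ρ 2 × PositiveBeyond 1 (ρ 2)
  first = positiveBeyond-suc 0 positiveBeyond-zero (ρ-radius 2 ℕ.≤-refl)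
  step : ∀ n → PositiveBeyond (suc n) (ρ (2 ℕ.+ n)) → ρ (2 ℕ.+ n) < ρ (3 ℕ.+ n) × PositiveBeyond (2 ℕ.+ n) (ρ (3 ℕ.+ n))
  step n beyond = positiveBeyond-suc (suc n) beyond (ρ-radius (3 ℕ.+ n) (s≤s (s≤s z≤n)))
  beyond : ∀ n → PositiveBeyond (suc n) (ρ (2 ℕ.+ n))
  beyond zero    = proj₂ first
  beyond (suc n) = proj₂ (step n (beyond n))
  increasing : ∀ n → 2 ℕ.≤ n → ρ n < ρ (suc n)
  increasing (suc (suc n)) _ = proj₁ (step n (beyond n))
  increasing (suc zero) (s≤s ())
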